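{- $\mathsf C_{2^{\mathbb N}}^\infty\equiv_{\mathrm{sW}}\mathsf C_{2^{\mathbb N}}$, $\mathsf C_{\mathbb N^{\mathbb N}}^\infty\equiv_{\mathrm{sW}}\mathsf C_{\mathbb N^{\mathbb N}}$, $\mathsf{UC}_{\mathbb N^{\mathbb N}}^\infty\equiv_{\mathrm{sW}}\mathsf{UC}_{\mathbb N^{\mathbb N}}$ and $\mathsf{WKL}^\infty\equiv_{\mathrm{sW}}\mathsf{WKL}$.
   Context: Problems. A represented space $(X,\delta_X)$ is a set $X$ with a surjective partial map $\delta_X:\subseteq\mathbb N^{\mathbb N}\to X$. A partial function $F:\subseteq\mathbb N^{\mathbb N}\to\mathbb N^{\mathbb N}$ is computable if there is a computable monotone (w.r.t. the prefix order) word function $\varphi:\mathbb N^*\to\mathbb N^*$ with $F(p)=\sup_{w\sqsubseteq p}\varphi(w)$ for all $p\in\mathrm{dom}(F)$. For a partial multivalued function $f:\subseteq X\rightrightarrows Y$ between represented spaces, $F:\subseteq\mathbb N^{\mathbb N}\to\mathbb N^{\mathbb N}$ is a realizer of $f$, written $F\vdash f$, if $\delta_YF(p)\in f\delta_X(p)$ for all $p\in\mathrm{dom}(f\delta_X)$. A problem is a multivalued function with a realizer. Composition: $g\circ f(x)=\{z:(\exists y\in f(x))\,z\in g(y)\}$ with $\mathrm{dom}(g\circ f)=\{x\in\mathrm{dom}(f):f(x)\subseteq\mathrm{dom}(g)\}$. The realizer version of $f$ is $f^{\mathrm r}:=\delta_Y^{ -1}\circ f\circ\delta_X:\subseteq\mathbb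 N^{\mathbb N}\rightrightarrows\mathbb N^{\mathbb N}$. Tupling. $\langle q,p\rangle:=q(0)p(0)q(1)p(1)\dots$, and $\langle p_0,p_1,p_2,\dots\rangle$ is the standard countable tupling, e.g. $\langle p_0,p_1,\dots\rangle(\langle i,j\rangle)=p_i(j)$. $\langle\mathrm{id}\times f\rangle$ is the problem $\langle q,p\rangle\mapsto\{\langle q,r\rangle:r\in f(p)\}$. Universal function. $\Phi$ is a fixed standard total representation of a set of continuous partial functions on $\mathbb N^{\mathbb N}$ (with natural domains), where a name $q$ encodes the graph of a monotone word function approximating $\Phi_q$; $\mathsf U_q:=\Phi_q$, and $\mathsf U\langle q,p\rangle:=\mathsf U_q(p)$ is a computable partial function. The smn-theorem holds: for every computable (continuous) $F:\subseteq\mathbb N^{\mathbb N}\to\mathbb N^{\mathbb N}$ there is a total computable (continuous) $S$ with $\mathsf U_{S(q)}(p)=F\langle q,p\rangle$ for all $\langle q,p\rangle\in\mathrm{dom}(F)$. Infinite loop. For a problem $f:\subseteq\mathbb N^{\mathbb N}\rightrightarrows\mathbb N^{\mathbb N}$, $f^\infty(q_0):=\{\langle q_0,q_1,q_2,\dots\rangle:(\forall i)\ q_{i+1}\in\mathsf U\circ\langle\mathrm{id}\times f\rangle(q_i)\}$, with $\mathrm{dom}(f^\infty)$ the set of all $q_0$ such that $A_0:=\{q_0\}\subseteq\mathrm{dom}(\mathsf U\circ\langle\mathrm{id}\times f\rangle)$ and $A_{i+1}:=\mathsf U\circ\langle\mathrm{id}\times f\rangle(A_i)\subseteq\mathrm{dom}(\mathsf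 U\circ\langle\mathrm{id}\times f\rangle)$ for all $i$. For arbitrary $f$, $f^\infty:=(f^{\mathrm r})^\infty$. Strong Weihrauch reducibility. $f\le_{\mathrm{sW}}g$ if there are computable $H,K:\subseteq\mathbb N^{\mathbb N}\to\mathbb N^{\mathbb N}$ with $HGK\vdash f$ whenever $G\vdash g$; $\equiv_{\mathrm{sW}}$ is the induced equivalence. Specific problems. $\mathsf C_X:\subseteq\mathcal A_-(X)\rightrightarrows X$, $B\mapsto B$, with domain the nonempty closed sets, where $\mathcal A_-(X)$ is the space of closed subsets of $X$ represented by negative information (a name of $B$ is an enumeration of cylinder sets whose union is $X\setminus B$, for $X=2^{\mathbb N},\mathbb N^{\mathbb N}$). $\mathsf{UC}_X$ is the restriction of $\mathsf C_X$ to singletons. $\mathsf{WKL}:\subseteq\mathrm{Tr}_2\rightrightarrows2^{\mathbb N}$, $T\mapsto[T]$, maps every infinite binary tree $T$ (given by its characteristic function) to the set $[T]$ of its infinite paths. -}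

module Defs where

open import Data.Bool.Base using (Bool; true; false; if_then_else_)
open import Data.Fin.Base using (Fin)
open import Data.List.Base using (List; []; _∷_; applyUpTo; length; map)
open import Data.List.Membership.Propositional using (_∉_)
open import Data.List.Relation.Binary.Prefix.Heterogeneous using (Prefix)
open import Data.List.Relation.Unary.All as All using (All; []; _∷_)
open import Data.Nat.Base using (ℕ; zero; suc; _+_; _≤_; _<_; _≡ᵇ_; s≤s; z<s; s<s)
open import Data.Nat.Properties
open import Data.Product.Base using (Σ; ∃; _×_; _,_; proj₁; proj₂; uncurry)
open import Data.Unit.Base using (⊤; tt)
open import Data.Vec.Base as Vec using (Vec; []; _∷_)
open import Data.Vec.Relation.Binary.Pointwise.Inductive using (Pointwise)
open import Function.Base using (_∘_; id)
open import Function.Bundles using (_⇔_; mk⇔; Equivalence)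
open import Function.Properties.Equivalence using (⇔-isEquivalence)
open import Level using (Level; _⊔_; 0ℓ) renaming (suc to lsuc)
open import Relation.Binary.Bundles using (Setoid)
open import Relation.Binary.PropositionalEquality
  using (_≡_; refl; sym; trans; cong; cong₂; subst; _≗_; _→-setoid_)
open import Relation.Binary.Structures using (IsEquivalence)
open import Relation.Nullary.Decidable using (does; dec-true; dec-false)
open import Relation.Nullary.Negation using (¬_)

private
  variable
    a b c d a′ b′ c′ d′ : Level
    L : Set

infix 4 _⊑_ _≺_
infixl 8 _↾_

_⊑_ : List L → List L → Set
_⊑_ = Prefix _≡_

_↾_ : (ℕ → L) → ℕ → List L
p ↾ n = applyUpTo p n

_≺_ : List L → (ℕ → L) → Set
w ≺ p = p ↾ length w ≡ w

↾-cong : {p q : ℕ → L} → p ≗ q → ∀ n → p ↾ n ≡ q ↾ n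
↾-cong p≗q zero    = refl
↾-cong p≗q (suc n) = cong₂ _∷_ (p≗q 0) (↾-cong (p≗q ∘ suc) n)

≺-resp : {w : List L} {p q : ℕ → L} → p ≗ q → w ≺ p → w ≺ q
≺-resp {w = w} p≗q w≺p = trans (sym (↾-cong p≗q (length w))) w≺p

Baire : Set
Baire = ℕ → ℕ

triangle : ℕ → ℕ
triangle zero    = 0
triangle (suc n) = suc n + triangle n

-- Cantor's pairing ⟨i , j⟩ = (i + j)(i + j + 1)/2 + j
pair : ℕ → ℕ → ℕ
pair i j = triangle (i + j) + j

-- walks along the diagonals, so that pair (next x) = suc (pair x)
next : ℕ × ℕ → ℕ × ℕ
next (zero  , j) = suc j , zero
next (suc i , j) = i , suc j

unpair : ℕ → ℕ × ℕ
unpair zero    = 0 , 0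
unpair (suc n) = next (unpair n)

pair-next : ∀ x → uncurry pair (next x) ≡ suc (uncurry pair x)
pair-next (zero  , j) rewrite +-identityʳ j | +-identityʳ (j + triangle j) =
  cong suc (+-comm j (triangle j))
pair-next (suc i , j) rewrite +-suc i j =
  +-suc (suc (i + j) + triangle (i + j)) j

pair-unpair : ∀ n → uncurry pair (unpair n) ≡ n
pair-unpair zero    = refl
pair-unpair (suc n) = trans (pair-next (unpair n)) (cong suc (pair-unpair n))

unpair-pair : ∀ i j → unpair (pair i j) ≡ (i , j)
unpair-pair i j = go (pair i j) i j refl
  where
  go : ∀ n i j → pair i j ≡ n → unpair n ≡ (i , j)
  go zero    zero    zero    _  = refl
  go (suc n) i       (suc j) eq =
    cong next (go n (suc i) j (suc-injective (trans (sym (pair-next (suc i , j))) eq)))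
  go (suc n) (suc i) zero    eq =
    cong next (go n 0 i (suc-injective (trans (sym (pair-next (0 , i))) eq)))
  go zero    (suc i) zero    ()
  go zero    i       (suc j) eq with trans (sym (+-suc (triangle (i + suc j)) j)) eq
  ... | ()

-- ⟨q , p⟩ = q(0) p(0) q(1) p(1) …
⟨_,_⟩ : Baire → Baire → Baire
⟨ q , p ⟩ zero    = q 0
⟨ q , p ⟩ (suc n) = ⟨ p , q ∘ suc ⟩ n

evens odds : Baire → Baire
evens s n = s (n + n)
odds  s n = s (suc (n + n))

evens-⟨,⟩ : ∀ q p → evens ⟨ q , p ⟩ ≗ q
evens-⟨,⟩ q p zero = refl
evens-⟨,⟩ q p (suc n) rewrite +-suc n n = evens-⟨,⟩ (q ∘ suc) (p ∘ suc) n

odds-⟨,⟩ : ∀ q p → odds ⟨ q , p ⟩ ≗ p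
odds-⟨,⟩ q p = evens-⟨,⟩ p (q ∘ suc)

⟨evens,odds⟩ : ∀ s → ⟨ evens s , odds s ⟩ ≗ s
⟨evens,odds⟩ s zero          = refl
⟨evens,odds⟩ s (suc zero)    = refl
⟨evens,odds⟩ s (suc (suc n)) =
  trans (cong-⟨,⟩ (λ m → cong (s ∘ suc) (+-suc m m)) (λ m → cong (s ∘ suc ∘ suc) (+-suc m m)) n)
        (⟨evens,odds⟩ (s ∘ suc ∘ suc) n)
  where
  cong-⟨,⟩ : ∀ {q q′ p p′} → q ≗ q′ → p ≗ p′ → ⟨ q , p ⟩ ≗ ⟨ q′ , p′ ⟩
  cong-⟨,⟩ q≗ p≗ zero    = q≗ 0
  cong-⟨,⟩ q≗ p≗ (suc n) = cong-⟨,⟩ p≗ (q≗ ∘ suc) n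

-- ⟨p₀ , p₁ , …⟩(⟨i , j⟩) = pᵢ(j)
⟨_⟩ω : (ℕ → Baire) → Baire
⟨ p ⟩ω n = p (proj₁ (unpair n)) (proj₂ (unpair n))

code : List ℕ → ℕ
code []      = 0
code (x ∷ w) = suc (pair x (code w))

decodeWithin : ℕ → ℕ → List ℕ
decodeWithin zero    _       = []
decodeWithin (suc k) zero    = []
decodeWithin (suc k) (suc n) = proj₁ (unpair n) ∷ decodeWithin k (proj₂ (unpair n))

-- the number itself is enough fuel, since proj₂ (unpair n) ≤ n
decode : ℕ → List ℕ
decode n = decodeWithin n n

decode-code : ∀ w → decode (code w) ≡ w
decode-code w = go w ≤-refl
  where
  go : ∀ {k} w → code w ≤ k → decodeWithin k (code w) ≡ w
  go {zero}  []      _ = refl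
  go {suc k} []      _ = refl
  go {suc k} (x ∷ w) (s≤s le) rewrite unpair-pair x (code w) =
    cong (x ∷_) (go w (≤-trans (m≤n+m (code w) (triangle (x + code w))) le))

code-decode : ∀ n → code (decode n) ≡ n
code-decode n = go n ≤-refl
  where
  unpair₂≤ : ∀ n → proj₂ (unpair n) ≤ n
  unpair₂≤ n = ≤-trans (m≤n+m _ _) (≤-reflexive (pair-unpair n))

  go : ∀ {k} n → n ≤ k → code (decodeWithin k n) ≡ n
  go {zero}  zero    _ = refl
  go {suc k} zero    _ = refl
  go {suc k} (suc n) (s≤s le) = cong suc
    (trans (cong (pair (proj₁ (unpair n))) (go (proj₂ (unpair n)) (≤-trans (unpair₂≤ n) le)))
           (pair-unpair n))

data Rec : ℕ → Set where
  zer  : ∀ {n} → Rec n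
  succ : Rec 1
  proj : ∀ {n} → Fin n → Rec n
  comp : ∀ {m n} → Rec m → Vec (Rec n) m → Rec n
  prec : ∀ {n} → Rec n → Rec (2 + n) → Rec (suc n)
  mu   : ∀ {n} → Rec (suc n) → Rec n

infix 4 _[_]⇓_

data _[_]⇓_ : ∀ {n} → Rec n → Vec ℕ n → ℕ → Set where
  zer  : ∀ {n} {xs : Vec ℕ n} → zer [ xs ]⇓ 0
  succ : ∀ {x} → succ [ x ∷ [] ]⇓ suc x
  proj : ∀ {n} {xs : Vec ℕ n} i → proj i [ xs ]⇓ Vec.lookup xs i
  comp : ∀ {m n} {g : Rec m} {hs : Vec (Rec n) m} {xs ys z} →
         Pointwise (λ h y → h [ xs ]⇓ y) hs ys → g [ ys ]⇓ z → comp g hs [ xs ]⇓ z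
  prec-zero : ∀ {n} {g : Rec n} {h xs y} →
         g [ xs ]⇓ y → prec g h [ 0 ∷ xs ]⇓ y
  prec-suc : ∀ {n} {g : Rec n} {h k xs y z} →
         prec g h [ k ∷ xs ]⇓ y → h [ k ∷ y ∷ xs ]⇓ z → prec g h [ suc k ∷ xs ]⇓ z
  mu   : ∀ {n} {g : Rec (suc n)} {xs y} →
         (∀ i → i < y → ∃ λ k → g [ i ∷ xs ]⇓ suc k) → g [ y ∷ xs ]⇓ 0 → mu g [ xs ]⇓ y

IsRecursive : (ℕ → ℕ) → Set
IsRecursive g = ∃ λ (e : Rec 1) → ∀ n → e [ n ∷ [] ]⇓ g n

WordFunction : Set
WordFunction = List ℕ → List ℕ

Monotone : WordFunction → Set
Monotone φ = ∀ {u v} → u ⊑ v → φ u ⊑ φ v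

IsComputableWF : WordFunction → Set
IsComputableWF φ = IsRecursive (code ∘ φ ∘ decode)

-- r = sup { φ w ∣ w prefix of p } in the prefix order on ℕ* ∪ ℕ^ℕ: the
-- infinite sequence r is the supremum of a set of words iff all these
-- words are prefixes of r and their lengths are unbounded.
record IsSup (φ : WordFunction) (p r : Baire) : Set where
  constructor _,_
  field
    bound     : ∀ n → φ (p ↾ n) ≺ r
    unbounded : ∀ n → ∃ λ m → n ≤ length (φ (p ↾ m))

record PartialFunction : Set₁ where
  field
    dom      : Baire → Set
    app      : ∀ p → dom p → Baire
    dom-resp : ∀ {p q} → p ≗ q → dom p → dom q
    app-cong : ∀ {p q} → p ≗ q → ∀ d e → app p d ≗ app q e

infixr 9 _⊙_

_⊙_ : PartialFunction → PartialFunction → PartialFunction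
G ⊙ F = record
  { dom      = λ p → Σ (F.dom p) λ d → G.dom (F.app p d)
  ; app      = λ p (d , e) → G.app (F.app p d) e
  ; dom-resp = λ p≗q (d , e) →
      F.dom-resp p≗q d , G.dom-resp (F.app-cong p≗q d _) e
  ; app-cong = λ p≗q (d , e) (d′ , e′) → G.app-cong (F.app-cong p≗q d d′) e e′
  }
  where
  module F = PartialFunction F
  module G = PartialFunction G

IsComputable : PartialFunction → Set
IsComputable F = ∃ λ (φ : WordFunction) →
  Monotone φ × IsComputableWF φ × (∀ p (d : dom p) → IsSup φ p (app p d))
  where open PartialFunction F

IsSup-resp : ∀ {φ ψ p p′ r r′} → φ ≗ ψ → p ≗ p′ → r ≗ r′ → IsSup φ p r → IsSup ψ p′ r′
IsSup-resp {φ} {ψ} {p} {p′} {r} {r′} φ≗ψ p≗p′ r≗r′ (bound , unbounded) =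
  (λ n → subst (_≺ r′) (eq n) (≺-resp r≗r′ (bound n))) ,
  (λ n → proj₁ (unbounded n) ,
         subst (λ w → n ≤ length w) (eq (proj₁ (unbounded n))) (proj₂ (unbounded n)))
  where
  eq : ∀ n → φ (p ↾ n) ≡ ψ (p′ ↾ n)
  eq n = trans (φ≗ψ (p ↾ n)) (cong ψ (↾-cong p≗p′ n))

≺-agree : ∀ {w : List ℕ} {r s} → w ≺ r → w ≺ s → ∀ {n} → n < length w → r n ≡ s n
≺-agree {w} w≺r w≺s n< = go (length w) (trans w≺r (sym w≺s)) n<
  where
  go : ∀ {r s : Baire} k → r ↾ k ≡ s ↾ k → ∀ {n} → n < k → r n ≡ s n
  go (suc k) eq {zero}  _       = cong (λ { (x ∷ _) → x ; [] → 0 }) eq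
  go (suc k) eq {suc n} (s≤s n<) =
    go k (cong (λ { (_ ∷ xs) → xs ; [] → [] }) eq) n<

IsSup-unique : ∀ {φ p r s} → IsSup φ p r → IsSup φ p s → r ≗ s
IsSup-unique (r-bound , unbounded) (s-bound , _) n with unbounded (suc n)
... | m , n< = ≺-agree (r-bound m) (s-bound m) n<

wordFunction : Baire → WordFunction
wordFunction q w = decode (q (code w))

-- A name q is the value table, i.e. the graph, of a word function, and
-- Φ q p = sup { wordFunction q w ∣ w prefix of p }, defined exactly where
-- this supremum exists and is infinite.  So Φ is total: if wordFunction q
-- is not monotone along p, then the words need not have a supremum and p
-- is outside the domain.
Φ : Baire → PartialFunction
Φ q = record
  { dom      = λ p → ∃ λ r → IsSup (wordFunction q) p r
  ; app      = λ p → proj₁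
  ; dom-resp = λ p≗p′ (r , s) → r , IsSup-resp (λ _ → refl) p≗p′ (λ _ → refl) s
  ; app-cong = λ p≗p′ (r , s) (r′ , s′) →
      IsSup-unique (IsSup-resp (λ _ → refl) p≗p′ (λ _ → refl) s) s′
  }

U : PartialFunction
U = record
  { dom      = λ s → PartialFunction.dom (Φ (evens s)) (odds s)
  ; app      = λ s → PartialFunction.app (Φ (evens s)) (odds s)
  ; dom-resp = λ s≗t (r , h) → r , resp s≗t h
  ; app-cong = λ s≗t (r , h) (r′ , h′) → IsSup-unique (resp s≗t h) h′
  }
  where
  resp : ∀ {s t r} → s ≗ t →
         IsSup (wordFunction (evens s)) (odds s) r → IsSup (wordFunction (evens t)) (odds t) r
  resp s≗t = IsSup-resp (λ w → cong decode (s≗t (code w + code w)))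
                        (λ n → s≗t (suc (n + n))) (λ _ → refl)

record RepresentedSpace c ℓ : Set (lsuc (c ⊔ ℓ)) where
  field
    setoid : Setoid c ℓ
  open Setoid setoid public using (Carrier; _≈_)
  field
    Name      : Baire → Set
    δ         : ∀ p → Name p → Carrier
    Name-resp : ∀ {p q} → p ≗ q → Name p → Name q
    δ-cong    : ∀ {p q} → p ≗ q → ∀ d e → δ p d ≈ δ q e
    δ-onto    : ∀ x → ∃ λ p → Σ (Name p) λ d → δ p d ≈ x

-- `values x y` means y ∈ f(x); it is only meaningful for x ∈ dom.
infix 2 _⇉_

record _⇉_ (X : RepresentedSpace a b) (Y : RepresentedSpace c d)
         : Set (a ⊔ b ⊔ c ⊔ d ⊔ lsuc 0ℓ) where
  private
    module X = RepresentedSpace X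
    module Y = RepresentedSpace Y
  field
    dom         : X.Carrier → Set
    values      : X.Carrier → Y.Carrier → Set
    dom-resp    : ∀ {x x′} → x X.≈ x′ → dom x → dom x′
    values-resp : ∀ {x x′ y y′} → x X.≈ x′ → y Y.≈ y′ → values x y → values x′ y′

baire : RepresentedSpace 0ℓ 0ℓ
baire = record
  { setoid    = ℕ →-setoid ℕ
  ; Name      = λ _ → ⊤
  ; δ         = λ p _ → p
  ; Name-resp = λ _ → id
  ; δ-cong    = λ p≗q _ _ → p≗q
  ; δ-onto    = λ p → p , tt , λ _ → refl
  }

-- The intermediate space is kept small so that `values` of a composite is.
infixr 9 _∙_

_∙_ : {X : RepresentedSpace a b} {Y : RepresentedSpace 0ℓ 0ℓ} {Z : RepresentedSpace c d} →
      Y ⇉ Z → X ⇉ Y → X ⇉ Z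
_∙_ {X = X} {Y} {Z} g f = record
  { dom         = λ x → f.dom x × (∀ y → f.values x y → g.dom y)
  ; values      = λ x z → ∃ λ y → f.values x y × g.values y z
  ; dom-resp    = λ x≈x′ (d , h) → f.dom-resp x≈x′ d ,
                    λ y v → h y (f.values-resp (X.sym x≈x′) Y.refl v)
  ; values-resp = λ x≈x′ z≈z′ (y , v , w) →
                    y , f.values-resp x≈x′ Y.refl v , g.values-resp Y.refl z≈z′ w
  }
  where
  module f = _⇉_ f
  module g = _⇉_ g
  module X = Setoid (RepresentedSpace.setoid X)
  module Y = Setoid (RepresentedSpace.setoid Y)

⌜_⌝ : PartialFunction → baire ⇉ baire
⌜ F ⌝ = record
  { dom         = dom
  ; values      = λ p q → Σ (dom p) λ d → app p d ≗ q
  ; dom-resp    = dom-resp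
  ; values-resp = λ p≗p′ q≗q′ (d , eq) → dom-resp p≗p′ d ,
      λ n → trans (app-cong (λ m → sym (p≗p′ m)) _ d n) (trans (eq n) (q≗q′ n))
  }
  where open PartialFunction F

infix 4 _⊢_ _≤sW_ _≡sW_

_⊢_ : {X : RepresentedSpace a b} {Y : RepresentedSpace c d} → PartialFunction → X ⇉ Y → Set
_⊢_ {X = X} {Y} F f =
  ∀ p (n : X.Name p) → f.dom (X.δ p n) →
  Σ (F.dom p) λ d → Σ (Y.Name (F.app p d)) λ m → f.values (X.δ p n) (Y.δ (F.app p d) m)
  where
  module X = RepresentedSpace X
  module Y = RepresentedSpace Y
  module F = PartialFunction F
  module f = _⇉_ f

_≤sW_ : {X : RepresentedSpace a b} {Y : RepresentedSpace c d}
        {Z : RepresentedSpace a′ b′} {W : RepresentedSpace c′ d′} →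
        X ⇉ Y → Z ⇉ W → Set₁
f ≤sW g = ∃ λ (H : PartialFunction) → ∃ λ (K : PartialFunction) →
  IsComputable H × IsComputable K × (∀ G → G ⊢ g → H ⊙ G ⊙ K ⊢ f)

_≡sW_ : {X : RepresentedSpace a b} {Y : RepresentedSpace c d}
        {Z : RepresentedSpace a′ b′} {W : RepresentedSpace c′ d′} →
        X ⇉ Y → Z ⇉ W → Set₁
f ≡sW g = f ≤sW g × g ≤sW f

-- δ_Y⁻¹ ∘ f ∘ δ_X, with the composition unfolded: as δ_X is single-valued
-- and δ_Y is onto, the domain is δ_X⁻¹(dom f).
_ʳ : {X : RepresentedSpace a b} {Y : RepresentedSpace c d} → X ⇉ Y → baire ⇉ baire
_ʳ {X = X} {Y} f = record
  { dom         = λ p → Σ (X.Name p) λ n → f.dom (X.δ p n)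
  ; values      = λ p q → Σ (X.Name p) λ n → Σ (Y.Name q) λ m → f.values (X.δ p n) (Y.δ q m)
  ; dom-resp    = λ p≗p′ (n , d) →
      X.Name-resp p≗p′ n , f.dom-resp (X.δ-cong p≗p′ n _) d
  ; values-resp = λ p≗p′ q≗q′ (n , m , v) →
      X.Name-resp p≗p′ n , Y.Name-resp q≗q′ m ,
      f.values-resp (X.δ-cong p≗p′ n _) (Y.δ-cong q≗q′ m _) v
  }
  where
  module X = RepresentedSpace X
  module Y = RepresentedSpace Y
  module f = _⇉_ f

-- ⟨q , p⟩ ↦ { ⟨q , r⟩ ∣ r ∈ f(p) }
⟨id×_⟩ : baire ⇉ baire → baire ⇉ baire
⟨id× f ⟩ = record
  { dom         = λ s → dom (odds s)
  ; values      = λ s t → ∃ λ r → values (odds s) r × t ≗ ⟨ evens s , r ⟩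
  ; dom-resp    = λ s≗s′ → dom-resp (λ n → s≗s′ (suc (n + n)))
  ; values-resp = λ s≗s′ t≗t′ (r , v , eq) →
      r , values-resp (λ n → s≗s′ (suc (n + n))) (λ _ → refl) v ,
      λ n → trans (sym (t≗t′ n)) (trans (eq n) (⟨⟩-congˡ r (λ m → s≗s′ (m + m)) n))
  }
  where
  open _⇉_ f

  ⟨⟩-congˡ : ∀ {q q′} r → q ≗ q′ → ⟨ q , r ⟩ ≗ ⟨ q′ , r ⟩
  ⟨⟩-congʳ : ∀ {q q′} r → q ≗ q′ → ⟨ r , q ⟩ ≗ ⟨ r , q′ ⟩
  ⟨⟩-congˡ r eq zero    = eq 0
  ⟨⟩-congˡ r eq (suc n) = ⟨⟩-congʳ r (eq ∘ suc) n
  ⟨⟩-congʳ r eq zero    = refl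
  ⟨⟩-congʳ r eq (suc n) = ⟨⟩-congˡ (r ∘ suc) eq n

step : baire ⇉ baire → baire ⇉ baire
step f = ⌜ U ⌝ ∙ ⟨id× f ⟩

-- A f q₀ i is the set Aᵢ of possible values after i steps from q₀.
A : baire ⇉ baire → Baire → ℕ → Baire → Set
A f q₀ zero    q = q ≗ q₀
A f q₀ (suc i) q = ∃ λ q′ → A f q₀ i q′ × _⇉_.values (step f) q′ q

A-resp : ∀ f {q₀ q₀′} → q₀ ≗ q₀′ → ∀ i {q} → A f q₀ i q → A f q₀′ i q
A-resp f q₀≗ zero    a            = λ n → trans (a n) (q₀≗ n)
A-resp f q₀≗ (suc i) (q′ , a , v) = q′ , A-resp f q₀≗ i a , v

loop : baire ⇉ baire → baire ⇉ baire
loop f = record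
  { dom         = λ q₀ → ∀ i q → A f q₀ i q → _⇉_.dom (step f) q
  ; values      = λ q₀ s → ∃ λ (q : ℕ → Baire) →
      q 0 ≗ q₀ × (∀ i → _⇉_.values (step f) (q i) (q (suc i))) × s ≗ ⟨ q ⟩ω
  ; dom-resp    = λ q₀≗ h i q a → h i q (A-resp f (λ n → sym (q₀≗ n)) i a)
  ; values-resp = λ q₀≗ s≗ (q , z , chain , eq) →
      q , (λ n → trans (z n) (q₀≗ n)) , chain , (λ n → trans (sym (s≗ n)) (eq n))
  }

infix 10 _ʳ _^∞

_^∞ : {X : RepresentedSpace a b} {Y : RepresentedSpace c d} → X ⇉ Y → baire ⇉ baire
f ^∞ = loop (f ʳ)

bit : Bool → ℕ
bit false = 0
bit true  = 1

bit-injective : ∀ {x y} → bit x ≡ bit y → x ≡ y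
bit-injective {false} {false} _ = refl
bit-injective {true}  {true}  _ = refl

cantor : RepresentedSpace 0ℓ 0ℓ
cantor = record
  { setoid    = ℕ →-setoid Bool
  ; Name      = λ p → ∃ λ x → bit ∘ x ≗ p
  ; δ         = λ p → proj₁
  ; Name-resp = λ p≗q (x , eq) → x , λ n → trans (eq n) (p≗q n)
  ; δ-cong    = λ p≗q (x , eq) (y , eq′) n →
      bit-injective (trans (eq n) (trans (p≗q n) (sym (eq′ n))))
  ; δ-onto    = λ x → bit ∘ x , (x , λ _ → refl) , λ _ → refl
  }

-- `sequence` is the inclusion into ℕ^ℕ (0-1 sequences in the case of 2^ℕ).
record SequenceSpace : Set₁ where
  field
    space : RepresentedSpace 0ℓ 0ℓ
  open RepresentedSpace space public
  field
    sequence      : Carrier → Baire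
    sequence-cong : ∀ {x y} → x ≈ y → sequence x ≗ sequence y

ℕ^ℕ 2^ℕ : SequenceSpace
ℕ^ℕ = record { space = baire  ; sequence = id ; sequence-cong = id }
2^ℕ = record { space = cantor ; sequence = bit ∘_ ; sequence-cong = λ x≗y n → cong bit (x≗y n) }

module _ (X : SequenceSpace) where
  open SequenceSpace X
  open Equivalence using (to; from)

  -- p lists the cylinders { x ∣ w ≺ x } with suc (code w) in the range of p.
  -- The value 0 lists nothing, so that the empty union can be listed; for
  -- 2^ℕ the same holds for words that are not binary.
  Outside : Baire → Carrier → Set
  Outside p x = ∀ n w → p n ≡ suc (code w) → ¬ (w ≺ sequence x)

  -- A set is closed if its complement is open; the open sets of these
  -- spaces are the unions of sequences of cylinders.
  ClosedSet : Set₁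
  ClosedSet = Σ (Carrier → Set) λ B → ∃ λ p → ∀ x → B x ⇔ Outside p x

  Outside-resp : ∀ {p q x y} → p ≗ q → x ≈ y → Outside p x → Outside q y
  Outside-resp p≗q x≈y out n w eq w≺y = out n w (trans (p≗q n) eq)
    (≺-resp (λ m → sym (sequence-cong x≈y m)) w≺y)

  A₋ : RepresentedSpace (lsuc 0ℓ) 0ℓ
  A₋ = record
    { setoid = record
      { Carrier       = ClosedSet
      ; _≈_           = λ (B , _) (C , _) → ∀ x → B x ⇔ C x
      ; isEquivalence = record
        { refl  = λ x → ⇔.refl
        ; sym   = λ e x → ⇔.sym (e x)
        ; trans = λ e e′ x → ⇔.trans (e x) (e′ x)
        }
      }
    ; Name      = λ _ → ⊤
    ; δ         = λ p _ → Outside p , p , λ x → ⇔.refl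
    ; Name-resp = λ _ → id
    ; δ-cong    = λ p≗q _ _ x → mk⇔
        (Outside-resp p≗q ≈.refl)
        (Outside-resp (λ n → sym (p≗q n)) ≈.refl)
    ; δ-onto    = λ (B , p , e) → p , tt , λ x → ⇔.sym (e x)
    }
    where
    module ⇔ {ℓ} = IsEquivalence (⇔-isEquivalence {ℓ})
    module ≈ = Setoid setoid

  private
    ∈-resp : {B B′ : ClosedSet} {x y : Carrier} →
             (∀ z → proj₁ B z ⇔ proj₁ B′ z) → x ≈ y → proj₁ B x → proj₁ B′ y
    ∈-resp {B , p , e} {x = x} {y} B≈B′ x≈y x∈B =
      to (B≈B′ y) (from (e y) (Outside-resp (λ _ → refl) x≈y (to (e x) x∈B)))

  C : A₋ ⇉ space
  C = record
    { dom         = λ (B , _) → ∃ B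
    ; values      = λ (B , _) x → B x
    ; dom-resp    = λ B≈B′ (x , x∈B) → x , to (B≈B′ x) x∈B
    ; values-resp = λ {B} {B′} {x} {y} → ∈-resp {B} {B′} {x} {y}
    }

  UC : A₋ ⇉ space
  UC = record
    { dom         = λ (B , _) → ∃ λ x → B x × (∀ y → B y → y ≈ x)
    ; values      = λ (B , _) x → B x
    ; dom-resp    = λ B≈B′ (x , x∈B , unique) →
        x , to (B≈B′ x) x∈B , λ y y∈B′ → unique y (from (B≈B′ y) y∈B′)
    ; values-resp = λ {B} {B′} {x} {y} → ∈-resp {B} {B′} {x} {y}
    }

record BinaryTree : Set where
  field
    χ             : List Bool → Bool
    prefix-closed : ∀ {u v} → u ⊑ v → χ v ≡ true → χ u ≡ true

open BinaryTree public

-- positive form of: the set of words in T is not finite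
IsInfinite : BinaryTree → Set
IsInfinite T = ∀ ws → ∃ λ w → χ T w ≡ true × w ∉ ws

IsPath : BinaryTree → (ℕ → Bool) → Set
IsPath T x = ∀ n → χ T (x ↾ n) ≡ true

-- p is the characteristic function of T, seen as a subset of ℕ*.
IsCharacteristic : Baire → BinaryTree → Set
IsCharacteristic p T = (∀ w → p (code (map bit w)) ≡ bit (χ T w))
                     × (∀ u → ¬ All (_< 2) u → p (code u) ≡ 0)

Tr₂ : RepresentedSpace 0ℓ 0ℓ
Tr₂ = record
  { setoid = record
    { Carrier       = BinaryTree
    ; _≈_           = λ S T → χ S ≗ χ T
    ; isEquivalence = record
      { refl  = λ _ → refl
      ; sym   = λ e w → sym (e w)
      ; trans = λ e e′ w → trans (e w) (e′ w)
      }
    }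
  ; Name      = λ p → ∃ (IsCharacteristic p)
  ; δ         = λ p → proj₁
  ; Name-resp = λ p≗q (T , on , off) → T ,
      (λ w → trans (sym (p≗q _)) (on w)) , λ u u≮2 → trans (sym (p≗q _)) (off u u≮2)
  ; δ-cong    = λ p≗q (S , on , _) (T , on′ , _) w →
      bit-injective (trans (sym (on w)) (trans (p≗q _) (on′ w)))
  ; δ-onto    = λ T → name T ∘ decode , (T ,
      (λ w → trans (cong (name T) (decode-code (map bit w))) (name-on T w)) ,
      (λ u u≮2 → trans (cong (name T) (decode-code u)) (name-off T u u≮2))) ,
      λ _ → refl
  }
  where
  name : BinaryTree → List ℕ → ℕ
  name T u = if does (All.all? (_<? 2) u) then bit (χ T (map (1 ≡ᵇ_) u)) else 0

  binary : ∀ w → All (_< 2) (map bit w)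
  binary []          = []
  binary (false ∷ w) = z<s ∷ binary w
  binary (true  ∷ w) = s<s z<s ∷ binary w

  unbit : ∀ w → map (1 ≡ᵇ_) (map bit w) ≡ w
  unbit []          = refl
  unbit (false ∷ w) = cong (false ∷_) (unbit w)
  unbit (true  ∷ w) = cong (true ∷_) (unbit w)

  name-on : ∀ T w → name T (map bit w) ≡ bit (χ T w)
  name-on T w
    rewrite dec-true (All.all? (_<? 2) (map bit w)) (binary w) | unbit w = refl

  name-off : ∀ T u → ¬ All (_< 2) u → name T u ≡ 0
  name-off T u u≮2 rewrite dec-false (All.all? (_<? 2) u) u≮2 = refl

WKL : Tr₂ ⇉ cantor
WKL = record
  { dom         = IsInfinite
  ; values      = IsPath
  ; dom-resp    = λ S≈T inf ws → let (w , w∈S , w∉ws) = inf ws in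
      w , trans (sym (S≈T w)) w∈S , w∉ws
  ; values-resp = λ {S} {T} S≈T x≗y path n →
      trans (cong (χ T) (sym (↾-cong x≗y n))) (trans (sym (S≈T _)) (path n))
  }

{-# OPTIONS --safe #-}

-- To reduce f to f^∞ for any f, a name p is turned into q₀ = ⟨s₀ , p⟩ such that U⟨s₀ , r⟩ is a pair
-- ⟨s₁ , p⟩ whose table s₁ lists prefixes of a fixed sequence, and r is recorded in the lengths of
-- these prefixes.  The fixed sequence is a pair ⟨s , p⟩ where s is a table of its own prefixes, so
-- that the loop never breaks off.
--
-- Conversely, the runs of the loop from q₀ form a closed set: a run q₀ , x₀ , q₁ , x₁ , … is stored
-- in a single sequence, where the concatenation of all qᵢ is given by the characteristic function
-- of its graph (so that it fits into 2^ℕ) and the answers xᵢ are given literally.  A violation of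
-- xᵢ ∈ f(odds qᵢ) or qᵢ₊₁ = U⟨evens qᵢ , xᵢ⟩ shows up in a finite prefix, and by definition of
-- dom(f^∞) the run from correct answers never gets stuck.  Given q₀, the sequence is determined
-- by the answers, so that uniqueness of the answers is preserved as well.
module Submission where

open import Data.Bool.Base using (Bool; true; false; if_then_else_; not; _∧_; _∨_; T)
open import Data.Bool.Properties using (T-≡; not-injective)
open import Data.Fin.Patterns using (0F; 1F; 2F)
open import Data.List.Base using (List; []; _∷_; _∷ʳ_; applyUpTo; length; map)
open import Data.List.Membership.Propositional using (_∈_)
open import Data.List.Properties using (length-applyUpTo; applyUpTo-∷ʳ; length-++; map-applyUpTo)
import Data.List.Relation.Binary.Pointwise as Pointwise
open import Data.List.Relation.Binary.Prefix.Heterogeneous as Prefix using ([]; _∷_; _++ᵖ_)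
import Data.List.Relation.Binary.Prefix.Heterogeneous.Properties as Prefixₚ
open import Data.List.Relation.Unary.All using (All; []; _∷_)
open import Data.List.Relation.Unary.Any using (here; there)
open import Data.Nat.Base
open import Data.Nat.ListAction using (sum)
open import Data.Nat.Properties
open import Data.Product.Base using (Σ; ∃; _×_; _,_; proj₁; proj₂; uncurry)
open import Data.Sum.Base as Sum using (_⊎_; inj₁; inj₂)
open import Data.Unit.Base using (tt)
open import Data.Vec.Base using ([]; _∷_)
open import Data.Vec.Relation.Binary.Pointwise.Inductive using ([]; _∷_)
open import Defs
open import Function.Base using (_∘_; id)
open import Function.Bundles using (Equivalence)
open import Level using (Level)
open import Relation.Binary.Bundles using (Setoid)
open import Relation.Binary.PropositionalEquality
  using (_≡_; refl; sym; trans; cong; cong₂; subst; _≗_)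
open import Relation.Nullary.Decidable.Core using (yes; no)
open import Relation.Nullary.Negation using (¬_; contradiction)
open import Relation.Nullary.Reflects
  using (Reflects; ofʸ; ofⁿ; fromEquivalence; _×-reflects_; _⊎-reflects_; ¬-reflects; T-reflects)

-- Strong reducibility shows the outer functional only the output of the inner problem. So a run of
-- f^∞ must reveal the first answer r, and a point of the closed set must contain every state, even
-- q₀. In the first reduction, p is the only input known to lie in the domain, so q₁ must have p as
-- its odd part and, as its even part, a table that is defined at every answer. Hence r has to be
-- hidden where the supremum does not notice it: the supremum of a table of prefixes does not depend
-- on their lengths, provided that these are unbounded. As names for Φ are value tables, all tables
-- are written down explicitly, and `fix` takes the place of the recursion theorem. In the second
-- reduction, the obstacle is that a 0-1 sequence being the graph of a total function is not a
-- closed condition. It is not imposed but proved by induction: a correctly encoded state has a next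
-- state by the definition of the domain, and the constraints then force every bit of the graph of
-- this next state.

-- Boolean reflection and pointwise equality

≡ᵇ-reflects : ∀ m n → Reflects (m ≡ n) (m ≡ᵇ n)
≡ᵇ-reflects m n = fromEquivalence (≡ᵇ⇒≡ m n) (≡⇒≡ᵇ m n)

reflects-true : ∀ {P : Set} {b} → Reflects P b → P → b ≡ true
reflects-true (ofʸ _)  _ = refl
reflects-true (ofⁿ ¬p) p = contradiction p ¬p

reflects-false : ∀ {P : Set} {b} → Reflects P b → ¬ P → b ≡ false
reflects-false (ofʸ p) ¬p = contradiction p ¬p
reflects-false (ofⁿ _) _  = refl

reflects-refuted : ∀ {P : Set} {b} → Reflects P b → b ≡ false → ¬ P
reflects-refuted (ofⁿ ¬p) refl = ¬p

reflects-proved : ∀ {P : Set} {b} → Reflects P b → b ≡ true → P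
reflects-proved (ofʸ p) refl = p

module _ {X Y : Set} where

  ≗-refl : {f : X → Y} → f ≗ f
  ≗-refl x = refl

  ≗-sym : {f g : X → Y} → f ≗ g → g ≗ f
  ≗-sym f≗g x = sym (f≗g x)

  ≗-trans : {f g h : X → Y} → f ≗ g → g ≗ h → f ≗ h
  ≗-trans f≗g g≗h x = trans (f≗g x) (g≗h x)

triangle-mono-≤ : ∀ {m n} → m ≤ n → triangle m ≤ triangle n
triangle-mono-≤ z≤n     = z≤n
triangle-mono-≤ (s≤s h) = +-mono-≤ (s≤s h) (triangle-mono-≤ h)

-- Recursive functions on coded data

addᴿ : Rec 2
addᴿ = prec (proj 0F) (comp succ (proj 1F ∷ []))

addᴿ-⇓ : ∀ m n → addᴿ [ m ∷ n ∷ [] ]⇓ m + n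
addᴿ-⇓ zero    n = prec-zero (proj 0F)
addᴿ-⇓ (suc m) n = prec-suc (addᴿ-⇓ m n) (comp (proj 1F ∷ []) succ)

predᴿ : Rec 1
predᴿ = prec zer (proj 0F)

predᴿ-⇓ : ∀ n → predᴿ [ n ∷ [] ]⇓ pred n
predᴿ-⇓ zero    = prec-zero zer
predᴿ-⇓ (suc n) = prec-suc (predᴿ-⇓ n) (proj 0F)

monusᴿ : Rec 2
monusᴿ = prec (proj 0F) (comp predᴿ (proj 1F ∷ []))

monusᴿ-⇓ : ∀ m n → monusᴿ [ n ∷ m ∷ [] ]⇓ m ∸ n
monusᴿ-⇓ m zero    = prec-zero (proj 0F)
monusᴿ-⇓ m (suc n) = subst (monusᴿ [ suc n ∷ m ∷ [] ]⇓_) (pred[m∸n]≡m∸[1+n] m n)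
  (prec-suc (monusᴿ-⇓ m n) (comp (proj 1F ∷ []) (predᴿ-⇓ _)))

triangleᴿ : Rec 1
triangleᴿ = prec zer (comp succ (addᴿ ∷ []))

triangleᴿ-⇓ : ∀ n → triangleᴿ [ n ∷ [] ]⇓ triangle n
triangleᴿ-⇓ zero    = prec-zero zer
triangleᴿ-⇓ (suc n) = prec-suc (triangleᴿ-⇓ n) (comp (addᴿ-⇓ _ _ ∷ []) succ)

pairᴿ : Rec 2
pairᴿ = comp addᴿ (comp triangleᴿ (addᴿ ∷ []) ∷ proj 1F ∷ [])

pairᴿ-⇓ : ∀ m n → pairᴿ [ m ∷ n ∷ [] ]⇓ pair m n
pairᴿ-⇓ m n =
  comp (comp (addᴿ-⇓ m n ∷ []) (triangleᴿ-⇓ _) ∷ proj 1F ∷ []) (addᴿ-⇓ _ _)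

beyondᴿ : Rec 2
beyondᴿ = comp monusᴿ
  (comp triangleᴿ (comp succ (proj 0F ∷ []) ∷ []) ∷ comp succ (proj 1F ∷ []) ∷ [])

beyondᴿ-⇓ : ∀ d n → beyondᴿ [ d ∷ n ∷ [] ]⇓ suc n ∸ triangle (suc d)
beyondᴿ-⇓ d n = comp
  (comp (comp (proj 0F ∷ []) succ ∷ []) (triangleᴿ-⇓ _) ∷ comp (proj 1F ∷ []) succ ∷ [])
  (monusᴿ-⇓ _ _)

-- pair i j lies on the diagonal d = i + j, the least d with pair i j < triangle (suc d).
diagonalᴿ : Rec 1
diagonalᴿ = mu beyondᴿ

diagonalᴿ-⇓ : ∀ i j → diagonalᴿ [ pair i j ∷ [] ]⇓ i + j
diagonalᴿ-⇓ i j = mu below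
  (subst (beyondᴿ [ i + j ∷ pair i j ∷ [] ]⇓_)
    (m≤n⇒m∸n≡0 {suc (pair i j)} {triangle (suc (i + j))}
      (s≤s (≤-trans (≤-reflexive (+-comm (triangle (i + j)) j))
                    (+-monoˡ-≤ (triangle (i + j)) (m≤n+m j i)))))
    (beyondᴿ-⇓ (i + j) (pair i j)))
  where
  below : ∀ d → d < i + j → ∃ λ k → beyondᴿ [ d ∷ pair i j ∷ [] ]⇓ suc k
  below d d< = _ , subst (beyondᴿ [ d ∷ pair i j ∷ [] ]⇓_)
    (+-∸-assoc 1 (≤-trans (triangle-mono-≤ d<) (m≤m+n (triangle (i + j)) j)))
    (beyondᴿ-⇓ d (pair i j))

sndᴿ : Rec 1
sndᴿ = comp monusᴿ (comp triangleᴿ (diagonalᴿ ∷ []) ∷ proj 0F ∷ [])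

sndᴿ-⇓ : ∀ i j → sndᴿ [ pair i j ∷ [] ]⇓ j
sndᴿ-⇓ i j = subst (sndᴿ [ pair i j ∷ [] ]⇓_) (m+n∸m≡n (triangle (i + j)) j)
  (comp (comp (diagonalᴿ-⇓ i j ∷ []) (triangleᴿ-⇓ _) ∷ proj 0F ∷ []) (monusᴿ-⇓ _ _))

fstᴿ : Rec 1
fstᴿ = comp monusᴿ (sndᴿ ∷ diagonalᴿ ∷ [])

fstᴿ-⇓ : ∀ i j → fstᴿ [ pair i j ∷ [] ]⇓ i
fstᴿ-⇓ i j = subst (fstᴿ [ pair i j ∷ [] ]⇓_) (m+n∸n≡m i j)
  (comp (sndᴿ-⇓ i j ∷ diagonalᴿ-⇓ i j ∷ []) (monusᴿ-⇓ _ _))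

-- Without eta and with copattern definitions of the instances, instances are compared by name
-- and not by unfolding the pairing function.
record Coded (X : Set) : Set where
  no-eta-equality
  field enc : X → ℕ

open Coded ⦃ ... ⦄ public

instance
  coded-ℕ : Coded ℕ
  coded-ℕ .Coded.enc n = n

  coded-Bool : Coded Bool
  coded-Bool .Coded.enc = bit

  coded-List : Coded (List ℕ)
  coded-List .Coded.enc = code

  coded-× : {X Y : Set} ⦃ _ : Coded X ⦄ ⦃ _ : Coded Y ⦄ → Coded (X × Y)
  coded-× .Coded.enc (x , y) = pair (enc x) (enc y)

-- All programs are unary. Several variables are packed into a context Γ by pairing and accessed by
-- `fstᶜ` and `sndᶜ` of `varᶜ`, much like de Bruijn indices.
record Computable {X Y : Set} ⦃ _ : Coded X ⦄ ⦃ _ : Coded Y ⦄ (f : X → Y) : Set where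
  constructor _computedBy_
  field
    program  : Rec 1
    computes : ∀ x → program [ enc x ∷ [] ]⇓ enc (f x)

natrec : {X : Set} → X → (ℕ → X → X) → ℕ → X
natrec z s zero    = z
natrec z s (suc n) = s n (natrec z s n)

-- A partial lookup: 0 stands for undefined and suc x for x.
at : List ℕ → ℕ → ℕ
at []      n       = 0
at (x ∷ w) zero    = suc x
at (x ∷ w) (suc n) = at w n

tail : List ℕ → List ℕ
tail []      = []
tail (x ∷ w) = w

anyBelow : ℕ → (ℕ → Bool) → Bool
anyBelow n P = natrec false (λ k b → P k ∨ b) n

allBelow : ℕ → (ℕ → Bool) → Bool
allBelow n P = natrec true (λ k b → P k ∧ b) n

module _ {Γ : Set} ⦃ _ : Coded Γ ⦄ where

  varᶜ : Computable {Γ} id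
  varᶜ = proj 0F computedBy λ _ → proj 0F

  module _ {X : Set} ⦃ _ : Coded X ⦄ where

    computable-≗ : {f g : Γ → X} → f ≗ g → Computable f → Computable g
    computable-≗ f≗g (e computedBy e⇓) =
      e computedBy λ γ → subst (e [ enc γ ∷ [] ]⇓_) (cong enc (f≗g γ)) (e⇓ γ)

    constᶜ : (x : X) → Computable {Γ} (λ _ → x)
    constᶜ x = numeral (enc x) computedBy λ _ → numeral-⇓ (enc x)
      where
      numeral : ℕ → Rec 1
      numeral zero    = zer
      numeral (suc n) = comp succ (numeral n ∷ [])

      numeral-⇓ : ∀ n {m} → numeral n [ m ∷ [] ]⇓ n
      numeral-⇓ zero    = zer
      numeral-⇓ (suc n) = comp (numeral-⇓ n ∷ []) succ

    module _ {Y : Set} ⦃ _ : Coded Y ⦄ where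

      infixl 9 _$ᶜ_
      infixr 4 _,ᶜ_

      _$ᶜ_ : {g : X → Y} {f : Γ → X} → Computable g → Computable f → Computable (g ∘ f)
      (d computedBy d⇓) $ᶜ (e computedBy e⇓) =
        comp d (e ∷ []) computedBy λ γ → comp (e⇓ γ ∷ []) (d⇓ _)

      _,ᶜ_ : {f : Γ → X} {g : Γ → Y} → Computable f → Computable g → Computable (λ γ → f γ , g γ)
      (d computedBy d⇓) ,ᶜ (e computedBy e⇓) =
        comp pairᴿ (d ∷ e ∷ []) computedBy λ γ → comp (d⇓ γ ∷ e⇓ γ ∷ []) (pairᴿ-⇓ _ _)

      fstᶜ : {f : Γ → X × Y} → Computable f → Computable (proj₁ ∘ f)
      fstᶜ {f} (e computedBy e⇓) = comp fstᴿ (e ∷ []) computedBy λ γ →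
        comp (e⇓ γ ∷ []) (fstᴿ-⇓ (enc (proj₁ (f γ))) (enc (proj₂ (f γ))))

      sndᶜ : {f : Γ → X × Y} → Computable f → Computable (proj₂ ∘ f)
      sndᶜ {f} (e computedBy e⇓) = comp sndᴿ (e ∷ []) computedBy λ γ →
        comp (e⇓ γ ∷ []) (sndᴿ-⇓ (enc (proj₁ (f γ))) (enc (proj₂ (f γ))))

    natrecᶜ : {z : Γ → X} {s : Γ × ℕ × X → X} {n : Γ → ℕ} →
              Computable z → Computable s → Computable n →
              Computable (λ γ → natrec (z γ) (λ k x → s (γ , k , x)) (n γ))
    natrecᶜ {z} {s} {n} (cz computedBy cz⇓) (cs computedBy cs⇓) (cn computedBy cn⇓) =
      comp recᴿ (cn ∷ proj 0F ∷ []) computedBy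
      λ γ → comp (cn⇓ γ ∷ proj 0F ∷ []) (recᴿ-⇓ γ (n γ))
      where
      recᴿ : Rec 2
      recᴿ = prec cz (comp cs
        (comp pairᴿ (proj 2F ∷ comp pairᴿ (proj 0F ∷ proj 1F ∷ []) ∷ []) ∷ []))

      recᴿ-⇓ : ∀ γ k → recᴿ [ k ∷ enc γ ∷ [] ]⇓ enc (natrec (z γ) (λ k x → s (γ , k , x)) k)
      recᴿ-⇓ γ zero    = prec-zero (cz⇓ γ)
      recᴿ-⇓ γ (suc k) = prec-suc (recᴿ-⇓ γ k)
        (comp (comp (proj 2F ∷ comp (proj 0F ∷ proj 1F ∷ []) (pairᴿ-⇓ _ _) ∷ [])
                    (pairᴿ-⇓ _ _) ∷ [])
              (cs⇓ _))

  sucᶜ : {f : Γ → ℕ} → Computable f → Computable (suc ∘ f)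
  sucᶜ (e computedBy e⇓) = comp succ (e ∷ []) computedBy λ γ → comp (e⇓ γ ∷ []) succ

  predᶜ : {f : Γ → ℕ} → Computable f → Computable (pred ∘ f)
  predᶜ (e computedBy e⇓) = comp predᴿ (e ∷ []) computedBy λ γ → comp (e⇓ γ ∷ []) (predᴿ-⇓ _)

  bitᶜ : {b : Γ → Bool} → Computable b → Computable (bit ∘ b)
  bitᶜ (e computedBy e⇓) = e computedBy e⇓

  module _ {f g : Γ → ℕ} where

    infixl 6 _+ᶜ_ _∸ᶜ_

    _+ᶜ_ : Computable f → Computable g → Computable (λ γ → f γ + g γ)
    (d computedBy d⇓) +ᶜ (e computedBy e⇓) =
      comp addᴿ (d ∷ e ∷ []) computedBy λ γ → comp (d⇓ γ ∷ e⇓ γ ∷ []) (addᴿ-⇓ _ _)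

    _∸ᶜ_ : Computable f → Computable g → Computable (λ γ → f γ ∸ g γ)
    (d computedBy d⇓) ∸ᶜ (e computedBy e⇓) =
      comp monusᴿ (e ∷ d ∷ []) computedBy λ γ → comp (e⇓ γ ∷ d⇓ γ ∷ []) (monusᴿ-⇓ _ _)

    pairᶜ : Computable f → Computable g → Computable (λ γ → pair (f γ) (g γ))
    pairᶜ (d computedBy d⇓) (e computedBy e⇓) =
      comp pairᴿ (d ∷ e ∷ []) computedBy λ γ → comp (d⇓ γ ∷ e⇓ γ ∷ []) (pairᴿ-⇓ _ _)

  -- On codes `unpair` is the identity, because the code of a pair is its `pair`; so the program for
  -- `f` serves unchanged. The same holds for `decode` below.
  unpairᶜ : {f : Γ → ℕ} → Computable f → Computable (unpair ∘ f)
  unpairᶜ {f} (e computedBy e⇓) = e computedBy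
    λ γ → subst (e [ enc γ ∷ [] ]⇓_) (sym (pair-unpair (f γ))) (e⇓ γ)

  codeᶜ : {f : Γ → List ℕ} → Computable f → Computable (code ∘ f)
  codeᶜ (e computedBy e⇓) = e computedBy e⇓

  decodeᶜ : {f : Γ → ℕ} → Computable f → Computable (decode ∘ f)
  decodeᶜ {f} (e computedBy e⇓) = e computedBy
    λ γ → subst (e [ enc γ ∷ [] ]⇓_) (sym (code-decode (f γ))) (e⇓ γ)

  consᶜ : {f : Γ → ℕ} {w : Γ → List ℕ} → Computable f → Computable w → Computable (λ γ → f γ ∷ w γ)
  consᶜ cf cw = let d computedBy d⇓ = sucᶜ (pairᶜ cf (codeᶜ cw)) in d computedBy d⇓

module _ {Γ : Set} ⦃ _ : Coded Γ ⦄ where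

  isZeroᶜ : {f : Γ → ℕ} → Computable f → Computable (λ γ → f γ ≡ᵇ 0)
  isZeroᶜ {f} cf = computable-≗ (λ γ → eq (f γ)) (natrecᶜ (constᶜ true) (constᶜ false) cf)
    where
    eq : ∀ n → natrec true (λ _ _ → false) n ≡ (n ≡ᵇ 0)
    eq zero    = refl
    eq (suc n) = refl

  -- A case distinction is a recursion of length `bit (b γ)`, that is, of at most one round.
  ifᶜ : {X : Set} ⦃ _ : Coded X ⦄ {b : Γ → Bool} {f g : Γ → X} →
        Computable b → Computable f → Computable g → Computable (λ γ → if b γ then f γ else g γ)
  ifᶜ {b = b} {f} {g} cb cf cg =
    computable-≗ eq (natrecᶜ cg (cf $ᶜ fstᶜ varᶜ) (bitᶜ cb))
    where
    eq : ∀ γ → natrec (g γ) (λ _ _ → f γ) (bit (b γ)) ≡ (if b γ then f γ else g γ)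
    eq γ with b γ
    ... | true  = refl
    ... | false = refl

  notᶜ : {b : Γ → Bool} → Computable b → Computable (not ∘ b)
  notᶜ {b} cb = computable-≗ (λ γ → eq (b γ)) (ifᶜ cb (constᶜ false) (constᶜ true))
    where
    eq : ∀ x → (if x then false else true) ≡ not x
    eq true  = refl
    eq false = refl

  module _ {b c : Γ → Bool} where

    infixr 3 _∧ᶜ_
    infixr 2 _∨ᶜ_

    _∧ᶜ_ : Computable b → Computable c → Computable (λ γ → b γ ∧ c γ)
    cb ∧ᶜ cc = computable-≗ (λ γ → eq (b γ)) (ifᶜ cb cc (constᶜ false))
      where
      eq : ∀ x {y} → (if x then y else false) ≡ (x ∧ y)
      eq true  = refl
      eq false = refl

    _∨ᶜ_ : Computable b → Computable c → Computable (λ γ → b γ ∨ c γ)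
    cb ∨ᶜ cc = computable-≗ (λ γ → eq (b γ)) (ifᶜ cb (constᶜ true) cc)
      where
      eq : ∀ x {y} → (if x then true else y) ≡ (x ∨ y)
      eq true  = refl
      eq false = refl

  module _ {f g : Γ → ℕ} where

    infix 5 _<ᵇᶜ_ _≡ᵇᶜ_

    _<ᵇᶜ_ : Computable f → Computable g → Computable (λ γ → f γ <ᵇ g γ)
    cf <ᵇᶜ cg = computable-≗ (λ γ → eq (f γ) (g γ)) (isZeroᶜ (sucᶜ cf ∸ᶜ cg))
      where
      eq : ∀ m n → (suc m ∸ n ≡ᵇ 0) ≡ (m <ᵇ n)
      eq m       zero    = refl
      eq zero    (suc n) = cong (_≡ᵇ 0) (0∸n≡0 n)
      eq (suc m) (suc n) = eq m n

    _≡ᵇᶜ_ : Computable f → Computable g → Computable (λ γ → f γ ≡ᵇ g γ)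
    cf ≡ᵇᶜ cg = computable-≗ (λ γ → eq (f γ) (g γ)) (isZeroᶜ ((cf ∸ᶜ cg) +ᶜ (cg ∸ᶜ cf)))
      where
      eq : ∀ m n → ((m ∸ n) + (n ∸ m) ≡ᵇ 0) ≡ (m ≡ᵇ n)
      eq zero    zero    = refl
      eq zero    (suc n) = refl
      eq (suc m) zero    = refl
      eq (suc m) (suc n) = eq m n

module _ {Γ : Set} ⦃ _ : Coded Γ ⦄ where

  module _ {n : Γ → ℕ} {P : Γ × ℕ → Bool} where

    anyBelowᶜ : Computable n → Computable P → Computable (λ γ → anyBelow (n γ) (λ k → P (γ , k)))
    anyBelowᶜ cn cP = natrecᶜ (constᶜ false)
      (cP $ᶜ (fstᶜ varᶜ ,ᶜ fstᶜ (sndᶜ varᶜ)) ∨ᶜ sndᶜ (sndᶜ varᶜ)) cn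

    allBelowᶜ : Computable n → Computable P → Computable (λ γ → allBelow (n γ) (λ k → P (γ , k)))
    allBelowᶜ cn cP = natrecᶜ (constᶜ true)
      (cP $ᶜ (fstᶜ varᶜ ,ᶜ fstᶜ (sndᶜ varᶜ)) ∧ᶜ sndᶜ (sndᶜ varᶜ)) cn

  tailᶜ : {w : Γ → List ℕ} → Computable w → Computable (tail ∘ w)
  tailᶜ {w} cw = computable-≗ (λ γ → eq (w γ)) (decodeᶜ (sndᶜ (unpairᶜ (predᶜ (codeᶜ cw)))))
    where
    eq : ∀ w → decode (proj₂ (unpair (pred (code w)))) ≡ tail w
    eq []      = refl
    eq (x ∷ w) rewrite unpair-pair x (code w) = decode-code w

module _ {Γ : Set} ⦃ _ : Coded Γ ⦄ where

  atᶜ : {w : Γ → List ℕ} {n : Γ → ℕ} → Computable w → Computable n →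
        Computable (λ γ → at (w γ) (n γ))
  atᶜ {w} {n} cw cn = computable-≗
    (λ γ → trans (first (drop (w γ) (n γ)))
                 (trans (at-drop (w γ) (n γ) 0) (cong (at (w γ)) (+-identityʳ (n γ)))))
    (ifᶜ (isZeroᶜ (codeᶜ cdrop)) (constᶜ 0) (sucᶜ (fstᶜ (unpairᶜ (predᶜ (codeᶜ cdrop))))))
    where
    drop : List ℕ → ℕ → List ℕ
    drop w = natrec w (λ _ → tail)

    cdrop : Computable (λ γ → drop (w γ) (n γ))
    cdrop = natrecᶜ cw (tailᶜ (sndᶜ (sndᶜ varᶜ))) cn

    first : ∀ w → (if code w ≡ᵇ 0 then 0 else suc (proj₁ (unpair (pred (code w))))) ≡ at w 0
    first []      = refl
    first (x ∷ w) rewrite unpair-pair x (code w) = refl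

    at-tail : ∀ w m → at (tail w) m ≡ at w (suc m)
    at-tail []      m = refl
    at-tail (x ∷ w) m = refl

    at-drop : ∀ w n m → at (drop w n) m ≡ at w (n + m)
    at-drop w zero    m = refl
    at-drop w (suc n) m = trans (at-tail (drop w n) m)
      (trans (at-drop w n (suc m)) (cong (at w) (+-suc n m)))

module _ {P : ℕ → Set} {b : ℕ → Bool} (reflects : ∀ k → Reflects (P k) (b k)) where

  anyBelow-reflects : ∀ n → Reflects (∃ λ k → k < n × P k) (anyBelow n b)
  anyBelow-reflects zero = ofⁿ λ ()
  anyBelow-reflects (suc n) with b n | reflects n | anyBelow n b | anyBelow-reflects n
  ... | true  | ofʸ p  | _     | _                  = ofʸ (n , ≤-refl , p)
  ... | false | ofⁿ ¬p | true  | ofʸ (k , k< , p) = ofʸ (k , m<n⇒m<1+n k< , p)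
  ... | false | ofⁿ ¬p | false | ofⁿ none           = ofⁿ λ (k , k< , p) → case k k< p
    where
    case : ∀ k → k < suc n → P k → _
    case k (s≤s k≤n) p with k ≟ n
    ... | yes refl = ¬p p
    ... | no k≢n   = none (k , ≤∧≢⇒< k≤n k≢n , p)

  allBelow-reflects : ∀ n → Reflects (∀ k → k < n → P k) (allBelow n b)
  allBelow-reflects zero = ofʸ λ _ ()
  allBelow-reflects (suc n) with b n | reflects n | allBelow n b | allBelow-reflects n
  ... | false | ofⁿ ¬p | _     | _         = ofⁿ λ all → ¬p (all n ≤-refl)
  ... | true  | ofʸ p  | false | ofⁿ ¬all  = ofⁿ λ all → ¬all λ k k< → all k (m<n⇒m<1+n k<)
  ... | true  | ofʸ p  | true  | ofʸ all   = ofʸ case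
    where
    case : ∀ k → k < suc n → P k
    case k (s≤s k≤n) with k ≟ n
    ... | yes refl = p
    ... | no k≢n   = all k (≤∧≢⇒< k≤n k≢n)

code≥length : ∀ w → length w ≤ code w
code≥length []      = z≤n
code≥length (x ∷ w) = s≤s (≤-trans (code≥length w) (m≤n+m (code w) (triangle (x + code w))))

length-decode≤ : ∀ n → length (decode n) ≤ n
length-decode≤ n = subst (length (decode n) ≤_) (code-decode n) (code≥length (decode n))

at-length : ∀ w {n} → length w ≤ n → at w n ≡ 0
at-length []      _         = refl
at-length (x ∷ w) (s≤s le) = at-length w le

at-suc : ∀ w {n} → n < length w → at w n ≡ suc (pred (at w n))
at-suc (x ∷ w) {zero}  _        = refl
at-suc (x ∷ w) {suc n} (s≤s lt) = at-suc w lt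

at-applyUpTo : ∀ f {m n} → n < m → at (applyUpTo f m) n ≡ suc (f n)
at-applyUpTo f {suc m} {zero}  _        = refl
at-applyUpTo f {suc m} {suc n} (s≤s lt) = at-applyUpTo (f ∘ suc) lt

pad : List ℕ → Baire
pad w n = pred (at w n)

module _ {Γ : Set} ⦃ _ : Coded Γ ⦄ where

  padᶜ : {w : Γ → List ℕ} {n : Γ → ℕ} → Computable w → Computable n →
         Computable (λ γ → pad (w γ) (n γ))
  padᶜ cw cn = predᶜ (atᶜ cw cn)

  -- Recursion on the structure of a coded word is not primitive recursion on its code. Instead all
  -- positions below `code w`, a bound for the length, are probed, and the successor of the last
  -- defined one is kept.
  lengthᶜ : {w : Γ → List ℕ} → Computable w → Computable (length ∘ w)
  lengthᶜ {w} cw = computable-≗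
    (λ γ → trans (eq (w γ) (code (w γ))) (m≥n⇒m⊓n≡n (code≥length (w γ))))
    (natrecᶜ (constᶜ 0)
      (ifᶜ (isZeroᶜ (atᶜ (cw $ᶜ fstᶜ varᶜ) (fstᶜ (sndᶜ varᶜ))))
           (sndᶜ (sndᶜ varᶜ)) (sucᶜ (fstᶜ (sndᶜ varᶜ))))
      (codeᶜ cw))
    where
    eq : ∀ w k → natrec 0 (λ i l → if at w i ≡ᵇ 0 then l else suc i) k ≡ k ⊓ length w
    eq w zero    = refl
    eq w (suc k) with k <? length w
    ... | yes k< rewrite at-suc w k< = sym (m≤n⇒m⊓n≡m k<)
    ... | no k≮  rewrite at-length w (≮⇒≥ k≮) = trans (eq w k)
      (trans (m≥n⇒m⊓n≡n (≮⇒≥ k≮)) (sym (m≥n⇒m⊓n≡n (m≤n⇒m≤1+n (≮⇒≥ k≮)))))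

  applyUpToᶜ : {f : Γ × ℕ → ℕ} {n : Γ → ℕ} → Computable f → Computable n →
               Computable (λ γ → applyUpTo (λ k → f (γ , k)) (n γ))
  applyUpToᶜ {f} {n} cf cn = computable-≗ (λ γ → trans (eq (λ k → f (γ , k)) (n γ) (n γ) ≤-refl)
      (↾-cong (λ j → cong (λ i → f (γ , i + j)) (n∸n≡0 (n γ))) (n γ)))
    (natrecᶜ (constᶜ [])
      (consᶜ (cf $ᶜ (fstᶜ varᶜ ,ᶜ cn $ᶜ fstᶜ varᶜ ∸ᶜ sucᶜ (fstᶜ (sndᶜ varᶜ)))) (sndᶜ (sndᶜ varᶜ)))
      cn)
    where
    -- Since symbols are added in front, the positions are visited downwards: after `k` rounds the
    -- last `k` symbols are present.
    from : (ℕ → ℕ) → ℕ → ℕ → List ℕ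
    from f n = natrec [] (λ k w → f (n ∸ suc k) ∷ w)

    eq : ∀ f n k → k ≤ n → from f n k ≡ applyUpTo (λ j → f (n ∸ k + j)) k
    eq f n zero    _  = refl
    eq f n (suc k) k< = cong₂ _∷_ (cong f (sym (+-identityʳ (n ∸ suc k))))
      (trans (eq f n k (<⇒≤ k<)) (↾-cong (λ j → cong f (shift j)) k))
      where
      shift : ∀ j → n ∸ k + j ≡ n ∸ suc k + suc j
      shift j = trans (cong (_+ j) (+-∸-assoc 1 k<)) (sym (+-suc (n ∸ suc k) j))

module _ {Γ : Set} ⦃ _ : Coded Γ ⦄ where

  ∷ʳᶜ : {w : Γ → List ℕ} {v : Γ → ℕ} → Computable w → Computable v → Computable (λ γ → w γ ∷ʳ v γ)
  ∷ʳᶜ {w} {v} cw cv = computable-≗ (λ γ → eq (w γ) (v γ))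
    (applyUpToᶜ
      (ifᶜ (sndᶜ varᶜ <ᵇᶜ lengthᶜ cw $ᶜ fstᶜ varᶜ)
           (padᶜ (cw $ᶜ fstᶜ varᶜ) (sndᶜ varᶜ)) (cv $ᶜ fstᶜ varᶜ))
      (sucᶜ (lengthᶜ cw)))
    where
    eq : ∀ w v → applyUpTo (λ k → if k <ᵇ length w then pad w k else v) (suc (length w)) ≡ w ∷ʳ v
    eq []      v = refl
    eq (x ∷ w) v = cong (x ∷_) (eq w v)

odd? : ℕ → Bool
odd? = natrec false (λ _ → not)

half : ℕ → ℕ
half = natrec 0 (λ k m → m + bit (odd? k))

-- The recursion of `⟨_,_⟩` changes its function arguments, which `natrecᶜ` cannot do; so parity and
-- half of the index are computed instead.
odd-half : ∀ q p n → ⟨ q , p ⟩ n ≡ (if odd? n then p (half n) else q (half n))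
odd-half q p zero    = refl
odd-half q p (suc n) with odd? n | odd-half p (q ∘ suc) n
... | true  | eq = trans eq (cong q (+-comm 1 (half n)))
... | false | eq = trans eq (cong p (sym (+-identityʳ (half n))))

module _ {Γ : Set} ⦃ _ : Coded Γ ⦄ where

  ⟨,⟩ᶜ : {q p : Γ × ℕ → ℕ} {n : Γ → ℕ} → Computable q → Computable p → Computable n →
         Computable (λ γ → ⟨ (λ k → q (γ , k)) , (λ k → p (γ , k)) ⟩ (n γ))
  ⟨,⟩ᶜ {q} {p} {n} cq cp cn = computable-≗
    (λ γ → sym (odd-half (λ k → q (γ , k)) (λ k → p (γ , k)) (n γ)))
    (ifᶜ (odd?ᶜ $ᶜ cn) (cp $ᶜ (varᶜ ,ᶜ halfᶜ $ᶜ cn)) (cq $ᶜ (varᶜ ,ᶜ halfᶜ $ᶜ cn)))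
    where
    odd?ᶜ : Computable odd?
    odd?ᶜ = natrecᶜ (constᶜ false) (notᶜ (sndᶜ (sndᶜ varᶜ))) varᶜ

    halfᶜ : Computable half
    halfᶜ = natrecᶜ (constᶜ 0) (sndᶜ (sndᶜ varᶜ) +ᶜ bitᶜ (odd?ᶜ $ᶜ fstᶜ (sndᶜ varᶜ))) varᶜ

-- Computable functionals on Baire space

⊑-refl : ∀ {w : List ℕ} → w ⊑ w
⊑-refl = Prefixₚ.fromPointwise (Pointwise.refl refl)

⊑-trans : ∀ {u v w : List ℕ} → u ⊑ v → v ⊑ w → u ⊑ w
⊑-trans = Prefixₚ.trans trans

⊑-at : ∀ {u v} → u ⊑ v → ∀ {n} → n < length u → at u n ≡ at v n
⊑-at (refl ∷ u⊑v) {zero}  _        = refl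
⊑-at (refl ∷ u⊑v) {suc n} (s≤s n<) = ⊑-at u⊑v n<

↾-local : ∀ {p q : Baire} n → (∀ {k} → k < n → p k ≡ q k) → p ↾ n ≡ q ↾ n
↾-local zero    p≡q = refl
↾-local (suc n) p≡q = cong₂ _∷_ (p≡q z<s) (↾-local n (p≡q ∘ s<s))

pad-↾ : ∀ (p : Baire) {n k} → k < n → pad (p ↾ n) k ≡ p k
pad-↾ p k< = cong pred (at-applyUpTo p k<)

natrec-local : ∀ {X : Set} {z : X} {s t : ℕ → X → X} n →
               (∀ {k} → k < n → ∀ x → s k x ≡ t k x) → natrec z s n ≡ natrec z t n
natrec-local zero    s≡t = refl
natrec-local {s = s} (suc n) s≡t =
  trans (cong (s n) (natrec-local n (λ k< → s≡t (m<n⇒m<1+n k<)))) (s≡t ≤-refl _)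

supremum : WordFunction → PartialFunction
supremum φ = record
  { dom      = λ p → ∃ λ r → IsSup φ p r
  ; app      = λ p → proj₁
  ; dom-resp = λ p≗q (r , s) → r , IsSup-resp (λ _ → refl) p≗q (λ _ → refl) s
  ; app-cong = λ p≗q (r , s) (r′ , s′) →
      IsSup-unique (IsSup-resp (λ _ → refl) p≗q (λ _ → refl) s) s′
  }

length-∷ʳ : ∀ (w : List ℕ) v → length (w ∷ʳ v) ≡ suc (length w)
length-∷ʳ w v = trans (length-++ w) (+-comm (length w) 1)

emit : List ℕ → ℕ → List ℕ
emit w zero    = w
emit w (suc v) = w ∷ʳ v

-- A machine that has read u and written n symbols waits if E (u , n) = 0 and
-- writes v if E (u , n) = suc v.
module Machine (E : List ℕ × ℕ → ℕ) where

  advance : Baire → ℕ → List ℕ → List ℕ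
  advance p k w = emit w (E (p ↾ k , length w))

  run : Baire → ℕ → List ℕ
  run p = natrec [] (advance p)

  output : WordFunction
  output w = run (pad w) (length w)

  machine : PartialFunction
  machine = supremum output

  run-local : ∀ {p q} n → (∀ {k} → k < n → p k ≡ q k) → run p n ≡ run q n
  run-local n p≡q = natrec-local n λ k< w →
    cong (λ u → emit w (E (u , length w))) (↾-local _ (λ j< → p≡q (<-trans j< k<)))

  ⊑-emit : ∀ w e → w ⊑ emit w e
  ⊑-emit w zero    = ⊑-refl
  ⊑-emit w (suc v) = ⊑-refl ++ᵖ (v ∷ [])

  run-mono : ∀ p {m n} → m ≤ n → run p m ⊑ run p n
  run-mono p m≤n = go (≤⇒≤′ m≤n)
    where
    go : ∀ {m n} → m ≤′ n → run p m ⊑ run p n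
    go ≤′-refl     = ⊑-refl
    go (≤′-step {n} h) = ⊑-trans (go h) (⊑-emit (run p n) (E (p ↾ n , length (run p n))))

  -- A run of `length u` steps looks only at the first `length u` symbols, so the padded `u` and the
  -- padded `v` agree that long; later steps only append.
  output-mono : Monotone output
  output-mono {u} {v} u⊑v = subst (_⊑ output v)
    (run-local (length u) (λ k< → cong pred (sym (⊑-at u⊑v k<))))
    (run-mono (pad v) (Prefixₚ.length-mono u⊑v))

  output-↾ : ∀ p n → run p n ≡ output (p ↾ n)
  output-↾ p n rewrite length-applyUpTo p n = run-local n (sym ∘ pad-↾ p)

  machine-computable : Computable E → IsComputable machine
  machine-computable cE = output , output-mono , recursive outputᶜ , λ _ → proj₂
    where
    recursive : {φ : WordFunction} → Computable φ → IsComputableWF φ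
    recursive {φ} (e computedBy e⇓) = e , λ n →
      subst (λ m → e [ m ∷ [] ]⇓ code (φ (decode n))) (code-decode n) (e⇓ (decode n))

    emitᶜ : {Γ : Set} ⦃ _ : Coded Γ ⦄ {w : Γ → List ℕ} {e : Γ → ℕ} →
            Computable w → Computable e → Computable (λ γ → emit (w γ) (e γ))
    emitᶜ {w = w} {e} cw ce = computable-≗ (λ γ → eq (w γ) (e γ))
      (ifᶜ (isZeroᶜ ce) cw (∷ʳᶜ cw (predᶜ ce)))
      where
      eq : ∀ w e → (if e ≡ᵇ 0 then w else w ∷ʳ pred e) ≡ emit w e
      eq w zero    = refl
      eq w (suc v) = refl

    outputᶜ : Computable output
    outputᶜ = natrecᶜ (constᶜ [])
      (emitᶜ (sndᶜ (sndᶜ varᶜ))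
        (cE $ᶜ (applyUpToᶜ (padᶜ (fstᶜ (fstᶜ varᶜ)) (sndᶜ varᶜ)) (fstᶜ (sndᶜ varᶜ))
               ,ᶜ lengthᶜ (sndᶜ (sndᶜ varᶜ)))))
      (lengthᶜ varᶜ)

  -- A symbol must be on offer at arbitrarily late times, since the machine may still be waiting to
  -- write earlier symbols when it is offered first.
  module _ {p r : Baire}
           (sound    : ∀ m n {v} → E (p ↾ m , n) ≡ suc v → v ≡ r n)
           (complete : ∀ n m → ∃ λ k → m ≤ k × ∃ λ v → E (p ↾ k , n) ≡ suc v)
         where

    run-≺ : ∀ m → run p m ≺ r
    run-≺ zero    = refl
    run-≺ (suc m) = extend (run p m) (run-≺ m) (sound m (length (run p m)))
      where
      extend : ∀ w {e} → w ≺ r → (∀ {v} → e ≡ suc v → v ≡ r (length w)) → emit w e ≺ r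
      extend w {zero}  w≺r _  = w≺r
      extend w {suc v} w≺r v≡ rewrite length-∷ʳ w v =
        trans (sym (applyUpTo-∷ʳ r (length w))) (cong₂ _∷ʳ_ w≺r (sym (v≡ refl)))

    run-unbounded : ∀ n → ∃ λ m → n ≤ length (run p m)
    run-unbounded zero    = 0 , z≤n
    run-unbounded (suc n) with run-unbounded n
    ... | m , n≤ with complete n m
    ... | k , m≤k , v , eq with n ≟ length (run p k)
    ... | yes refl = suc k ,
      ≤-reflexive (sym (trans (cong (length ∘ emit (run p k)) eq) (length-∷ʳ (run p k) v)))
    ... | no n≢    = k , ≤∧≢⇒< (≤-trans n≤ (Prefixₚ.length-mono (run-mono p m≤k))) n≢

    isSup : IsSup output p r
    isSup = (λ n → subst (_≺ r) (output-↾ p n) (run-≺ n)) ,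
            (λ n → let (m , n≤) = run-unbounded n
                   in m , subst (λ w → n ≤ length w) (output-↾ p m) n≤)

-- With this modulus of continuity, the symbol `n` can be computed from any padded prefix longer
-- than `n`. The inner functionals of all reductions have this form because a number bounds the
-- length of the word that it codes.
Causal : (Baire → Baire) → Set
Causal F = ∀ {p q} n → (∀ {k} → k ≤ n → p k ≡ q k) → F p n ≡ F q n

module Transducer (F : Baire → Baire) where

  transition : List ℕ × ℕ → ℕ
  transition (w , n) = if n <ᵇ length w then suc (F (pad w) n) else 0

  open Machine transition public renaming (machine to transducer) using (output)

  transducer-computable : Computable (λ ((w , n) : List ℕ × ℕ) → F (pad w) n) →
                          IsComputable transducer
  transducer-computable cF = Machine.machine-computable transition
    (ifᶜ (sndᶜ varᶜ <ᵇᶜ lengthᶜ (fstᶜ varᶜ)) (sucᶜ cF) (constᶜ 0))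

  module _ (causal : Causal F) where

    transition-early : ∀ {p m n} → n < m → transition (p ↾ m , n) ≡ suc (F p n)
    transition-early {p} {m} {n} n<m
      rewrite length-applyUpTo p m | reflects-true (<ᵇ-reflects-< n m) n<m =
      cong suc (causal n (λ k≤n → pad-↾ p (≤-<-trans k≤n n<m)))

    transduce : ∀ p → IsSup output p (F p)
    transduce p = Machine.isSup transition {p} {F p} sound
      (λ n m → suc n ⊔ m , m≤n⊔m (suc n) m , _ , transition-early (m≤m⊔n (suc n) m))
      where
      sound : ∀ m n {v} → transition (p ↾ m , n) ≡ suc v → v ≡ F p n
      sound m n eq with n <? m
      ... | yes n<m = suc-injective (trans (sym eq) (transition-early n<m))
      ... | no n≮m rewrite length-applyUpTo p m | reflects-false (<ᵇ-reflects-< n m) n≮m =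
        contradiction eq λ ()

-- The reduction of f to f^∞

i≤pair : ∀ i j → i ≤ pair i j
i≤pair i j = ≤-trans (≤-trans (m≤m+n i j) (n≤triangle (i + j))) (m≤m+n (triangle (i + j)) j)
  where
  n≤triangle : ∀ n → n ≤ triangle n
  n≤triangle zero    = z≤n
  n≤triangle (suc n) = m≤m+n (suc n) (triangle n)

j≤pair : ∀ i j → j ≤ pair i j
j≤pair i j = m≤n+m j (triangle (i + j))

index+symbol≤code : ∀ w {n} → n < length w → n + pad w n ≤ code w
index+symbol≤code (x ∷ w) {zero}  _        = m≤n⇒m≤1+n (i≤pair x (code w))
index+symbol≤code (x ∷ w) {suc n} (s≤s n<) =
  s≤s (≤-trans (index+symbol≤code w n<) (j≤pair x (code w)))

⟨,⟩-local : ∀ {q q′ p p′} n → (∀ {k} → k ≤ n → q k ≡ q′ k) → (∀ {k} → k ≤ n → p k ≡ p′ k) →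
            ⟨ q , p ⟩ n ≡ ⟨ q′ , p′ ⟩ n
⟨,⟩-local zero    q≡ p≡ = q≡ z≤n
⟨,⟩-local (suc n) q≡ p≡ = ⟨,⟩-local n (p≡ ∘ m≤n⇒m≤1+n) (q≡ ∘ s≤s)

evens-≗ : ∀ {y s x} → y ≗ ⟨ s , x ⟩ → evens y ≗ s
evens-≗ {s = s} {x} y≗ n = trans (y≗ (n + n)) (evens-⟨,⟩ s x n)

odds-≗ : ∀ {y s x} → y ≗ ⟨ s , x ⟩ → odds y ≗ x
odds-≗ {s = s} {x} y≗ n = trans (y≗ (suc (n + n))) (odds-⟨,⟩ s x n)

wordFunction-resp : ∀ {s t} → s ≗ t → wordFunction s ≗ wordFunction t
wordFunction-resp s≗t w = cong decode (s≗t (code w))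

module _ (g : baire ⇉ baire) {q s p : Baire} (q≗ : q ≗ ⟨ s , p ⟩) where
  private module g = _⇉_ g

  step-dom : g.dom p → (∀ {r} → g.values p r → ∃ λ t → IsSup (wordFunction s) r t) →
             _⇉_.dom (step g) q
  step-dom d sup = g.dom-resp (≗-sym (odds-≗ q≗)) d , λ y (r , v , y≗) →
    let (t , is) = sup (g.values-resp (odds-≗ q≗) ≗-refl v)
    in t , IsSup-resp (≗-sym (wordFunction-resp (≗-trans (evens-≗ y≗) (evens-≗ q≗))))
                      (≗-sym (odds-≗ y≗)) ≗-refl is

  step-values : ∀ {q′} → _⇉_.values (step g) q q′ →
                ∃ λ r → g.values p r × IsSup (wordFunction s) r q′
  step-values (y , (r , v , y≗) , (t , is) , t≗) = r , g.values-resp (odds-≗ q≗) ≗-refl v ,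
    IsSup-resp (wordFunction-resp (≗-trans (evens-≗ y≗) (evens-≗ q≗))) (odds-≗ y≗) t≗ is

  step-intro : ∀ {q′ r} → g.values p r → IsSup (wordFunction s) r q′ → _⇉_.values (step g) q q′
  step-intro {q′} {r} v is = ⟨ evens q , r ⟩ ,
    (r , g.values-resp (≗-sym (odds-≗ q≗)) ≗-refl v , ≗-refl) ,
    (q′ , IsSup-resp (wordFunction-resp (≗-sym (≗-trans (evens-⟨,⟩ _ r) (evens-≗ q≗))))
                     (≗-sym (odds-⟨,⟩ (evens q) r)) ≗-refl is) , ≗-refl

-- fix p is the sequence with fix p = ⟨(c ↦ code (fix p ↾ c)) , p⟩.  Its n-th symbol only depends on
-- the symbols before, hence it can be computed along its prefixes.
fixPrefix : Baire → ℕ → List ℕ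
fixPrefix p = natrec [] λ k w → w ∷ʳ ⟨ (λ c → code (pad w ↾ c)) , p ⟩ k

fix : Baire → Baire
fix p n = ⟨ (λ c → code (pad (fixPrefix p n) ↾ c)) , p ⟩ n

fixPrefix≡ : ∀ p n → fixPrefix p n ≡ fix p ↾ n
fixPrefix≡ p zero    = refl
fixPrefix≡ p (suc n) = trans (cong (_∷ʳ fix p n) (fixPrefix≡ p n)) (applyUpTo-∷ʳ (fix p) n)

fix≗ : ∀ p → fix p ≗ ⟨ (λ c → code (fix p ↾ c)) , p ⟩
fix≗ p n = ⟨,⟩-local n
  (λ {c} c≤n → cong code (↾-local c λ k< →
    trans (cong (λ w → pad w _) (fixPrefix≡ p n)) (pad-↾ (fix p) (<-≤-trans k< c≤n))))
  (λ _ → refl)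

fix-local : ∀ {p q} n → (∀ {k} → k < n → p k ≡ q k) → fix p ↾ n ≡ fix q ↾ n
fix-local {p} {q} n p≡q = trans (sym (fixPrefix≡ p n)) (trans
  (natrec-local n λ k< w → cong (w ∷ʳ_) (⟨,⟩-local _ (λ _ → refl) (λ j≤k → p≡q (≤-<-trans j≤k k<))))
  (fixPrefix≡ q n))

-- The summand `c` makes the lengths unbounded along the prefixes of every further answer, whatever
-- `r` is, and it can be subtracted again to recover `r c`. Only lengths depend on `r`, so the next
-- state is always `fix p`.
logged : Baire → Baire → Baire
logged p r = ⟨ (λ c → code (fix p ↾ (c + r c))) , p ⟩

-- The first component is a table of r ↦ logged p r.  Its value at d only needs p ↾ d, because
-- c + w(c) ≤ code w for each position c of w.
start : Baire → Baire
start p = ⟨ (λ d → code (logged p (pad (decode d)) ↾ length (decode d))) , p ⟩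

start-causal : Causal start
start-causal {p} {q} n p≡q = ⟨,⟩-local n
  (λ {d} d≤n → cong code (↾-local (length (decode d)) λ {j} j< →
    ⟨,⟩-local j
      (λ {c} c≤j → cong code (fix-local (c + pad (decode d) c) λ k< →
        p≡q (<⇒≤ (<-≤-trans k< (≤-trans (symbol≤ d (≤-<-trans c≤j j<)) d≤n)))))
      (λ k≤j → p≡q (≤-trans k≤j (≤-trans (<⇒≤ j<) (≤-trans (length-decode≤ d) d≤n))))))
  p≡q
  where
  symbol≤ : ∀ d {c} → c < length (decode d) → c + pad (decode d) c ≤ d
  symbol≤ d {c} c< =
    subst (c + pad (decode d) c ≤_) (code-decode d) (index+symbol≤code (decode d) c<)

-- `IsSup` asks that the words be prefixes of `t` of unbounded length, not that they grow with the
-- argument, and it consults only the codes of prefixes of `r`. So the lengths `ℓ` may vary freely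
-- above the bound `n`, which allows them to carry information.
table-sup : ∀ (q : ℕ → Baire) (ℓ : ℕ → ℕ) {r t} →
            (∀ n → q (code (r ↾ n)) ↾ ℓ (code (r ↾ n)) ≡ t ↾ ℓ (code (r ↾ n))) →
            (∀ n → n ≤ ℓ (code (r ↾ n))) → IsSup (wordFunction (λ c → code (q c ↾ ℓ c))) r t
table-sup q ℓ {r} {t} q≡t n≤ =
  (λ n → subst (_≺ t) (sym (word n)) (cong (t ↾_) (length-applyUpTo t (ℓ (code (r ↾ n)))))) ,
  (λ n → n , subst (λ w → n ≤ length w) (sym (word n))
                   (subst (n ≤_) (sym (length-applyUpTo t (ℓ (code (r ↾ n))))) (n≤ n)))
  where
  word : ∀ n → wordFunction (λ c → code (q c ↾ ℓ c)) (r ↾ n) ≡ t ↾ ℓ (code (r ↾ n))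
  word n = trans (decode-code (q (code (r ↾ n)) ↾ ℓ (code (r ↾ n)))) (q≡t n)

n≤code↾ : ∀ r n → n ≤ code (r ↾ n)
n≤code↾ r n = subst (_≤ code (r ↾ n)) (length-applyUpTo r n) (code≥length (r ↾ n))

start-sup : ∀ p r → IsSup
  (wordFunction (λ d → code (logged p (pad (decode d)) ↾ length (decode d)))) r (logged p r)
start-sup p r = table-sup (λ d → logged p (pad (decode d))) (length ∘ decode)
  (λ n → trans (cong (λ w → logged p (pad w) ↾ length w) (decode-code (r ↾ n)))
    (trans (↾-local (length (r ↾ n)) λ {j} j< → ⟨,⟩-local j
             (λ {c} c≤j → cong (λ m → code (fix p ↾ (c + m)))
               (pad-↾ r (subst (c <_) (length-applyUpTo r n) (≤-<-trans c≤j j<))))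
             (λ _ → refl))
           (cong (λ w → logged p r ↾ length w) (sym (decode-code (r ↾ n))))))
  (λ n → ≤-reflexive (sym (trans (cong length (decode-code (r ↾ n))) (length-applyUpTo r n))))

logged-sup : ∀ p (r : Baire) r′ → IsSup (wordFunction (λ c → code (fix p ↾ (c + r c)))) r′ (fix p)
logged-sup p r r′ = table-sup (λ _ → fix p) (λ c → c + r c) (λ _ → refl)
  (λ n → ≤-trans (n≤code↾ r′ n) (m≤m+n (code (r′ ↾ n)) (r (code (r′ ↾ n)))))

fix-sup : ∀ p r → IsSup (wordFunction (λ c → code (fix p ↾ c))) r (fix p)
fix-sup p r = table-sup (λ _ → fix p) id (λ _ → refl) (n≤code↾ r)

module Start = Transducer start

start-computable : IsComputable Start.transducer
start-computable = Start.transducer-computable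
  (⟨,⟩ᶜ (codeᶜ (applyUpToᶜ
           (loggedᶜ (fstᶜ (fstᶜ (fstᶜ varᶜ))) (decodeᶜ (sndᶜ (fstᶜ varᶜ))) (sndᶜ varᶜ))
           (lengthᶜ (decodeᶜ (sndᶜ varᶜ)))))
        (padᶜ (fstᶜ (fstᶜ varᶜ)) (sndᶜ varᶜ)) (sndᶜ varᶜ))
  where
  module _ {Γ : Set} ⦃ _ : Coded Γ ⦄ {u : Γ → List ℕ} (cu : Computable u) where

    fixPrefixᶜ : {n : Γ → ℕ} → Computable n → Computable (λ γ → fixPrefix (pad (u γ)) (n γ))
    fixPrefixᶜ = natrecᶜ (constᶜ [])
      (∷ʳᶜ (sndᶜ (sndᶜ varᶜ))
        (⟨,⟩ᶜ (codeᶜ (applyUpToᶜ (padᶜ (sndᶜ (sndᶜ (fstᶜ (fstᶜ varᶜ)))) (sndᶜ varᶜ)) (sndᶜ varᶜ)))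
              (padᶜ (cu $ᶜ fstᶜ (fstᶜ varᶜ)) (sndᶜ varᶜ)) (fstᶜ (sndᶜ varᶜ))))

  loggedᶜ : {Γ : Set} ⦃ _ : Coded Γ ⦄ {u v : Γ → List ℕ} {n : Γ → ℕ} → Computable u → Computable v →
            Computable n → Computable (λ γ → logged (pad (u γ)) (pad (v γ)) (n γ))
  loggedᶜ {u = u} {v} cu cv cn = ⟨,⟩ᶜ
    (computable-≗ (λ (γ , c) → cong code (fixPrefix≡ (pad (u γ)) (c + pad (v γ) c)))
      (codeᶜ (fixPrefixᶜ (cu $ᶜ fstᶜ varᶜ) (sndᶜ varᶜ +ᶜ padᶜ (cv $ᶜ fstᶜ varᶜ) (sndᶜ varᶜ)))))
    (padᶜ (cu $ᶜ fstᶜ varᶜ) (sndᶜ varᶜ)) cn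

-- Recovers r(n) from the run ⟨start p , logged p r , …⟩ω, whose symbol at ⟨1 , 2n⟩ is the code of a
-- word of length n + r(n).
excess : List ℕ × ℕ → ℕ
excess (w , n) = if x ≡ᵇ 0 then 0 else suc (length (decode (pred x)) ∸ n)
  where
  x = at w (pair 1 (n + n))

module Excess = Machine excess

excess-computable : Computable excess
excess-computable = ifᶜ (isZeroᶜ x) (constᶜ 0) (sucᶜ (lengthᶜ (decodeᶜ (predᶜ x)) ∸ᶜ sndᶜ varᶜ))
  where
  x = atᶜ (fstᶜ varᶜ) (pairᶜ (constᶜ 1) (sndᶜ varᶜ +ᶜ sndᶜ varᶜ))

excess-sup : ∀ {o p r} → (∀ n → o (pair 1 (n + n)) ≡ logged p r (n + n)) → IsSup Excess.output o r
excess-sup {o} {p} {r} o≡ = Excess.isSup {o} {r} sound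
  (λ n m → suc (pair 1 (n + n)) ⊔ m , m≤n⊔m (suc (pair 1 (n + n))) m , r n ,
     read n _ (m≤m⊔n (suc (pair 1 (n + n))) m))
  where
  read : ∀ n m → pair 1 (n + n) < m → excess (o ↾ m , n) ≡ suc (r n)
  read n m <m rewrite at-applyUpTo o <m | o≡ n
    | evens-⟨,⟩ (λ c → code (fix p ↾ (c + r c))) p n
    | decode-code (fix p ↾ (n + r n)) | length-applyUpTo (fix p) (n + r n) =
    cong suc (m+n∸m≡n n (r n))

  sound : ∀ m n {v} → excess (o ↾ m , n) ≡ suc v → v ≡ r n
  sound m n eq with pair 1 (n + n) <? m
  ... | yes <m = suc-injective (trans (sym eq) (read n m <m))
  ... | no ≮m rewrite at-length (o ↾ m)
    (subst (_≤ pair 1 (n + n)) (sym (length-applyUpTo o m)) (≮⇒≥ ≮m)) =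
    contradiction eq λ ()

module _ (g : baire ⇉ baire) (p : Baire) (p∈dom : _⇉_.dom g p) where

  -- The states at time 0, at time 1 and from time 2 on. Only the first answer leaves a trace;
  -- `fix p` leads back to itself under every answer.
  Reachable : Baire → Set
  Reachable q = q ≗ start p ⊎ (∃ λ r → q ≗ logged p r) ⊎ q ≗ fix p

  reachable-dom : ∀ {q} → Reachable q → _⇉_.dom (step g) q
  reachable-dom (inj₁ q≗)              = step-dom g q≗ p∈dom λ {r} _ → _ , start-sup p r
  reachable-dom (inj₂ (inj₁ (r , q≗))) = step-dom g q≗ p∈dom λ {r′} _ → _ , logged-sup p r r′
  reachable-dom (inj₂ (inj₂ q≗))       =
    step-dom g (≗-trans q≗ (fix≗ p)) p∈dom λ {r} _ → _ , fix-sup p r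

  reachable-step : ∀ {q q′} → Reachable q → _⇉_.values (step g) q q′ → Reachable q′
  reachable-step (inj₁ q≗) v = let (r , _ , is) = step-values g q≗ v in
    inj₂ (inj₁ (r , IsSup-unique is (start-sup p r)))
  reachable-step (inj₂ (inj₁ (r , q≗))) v = let (r′ , _ , is) = step-values g q≗ v in
    inj₂ (inj₂ (IsSup-unique is (logged-sup p r r′)))
  reachable-step (inj₂ (inj₂ q≗)) v = let (r , _ , is) = step-values g (≗-trans q≗ (fix≗ p)) v in
    inj₂ (inj₂ (IsSup-unique is (fix-sup p r)))

  reachable : ∀ i {q} → A g (start p) i q → Reachable q
  reachable zero    q≗           = inj₁ q≗
  reachable (suc i) (q′ , a , v) = reachable-step (reachable i a) v

  start-dom : _⇉_.dom (loop g) (start p)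
  start-dom i q a = reachable-dom (reachable i a)

module _ {a b c d : Level} {X : RepresentedSpace a b} {Y : RepresentedSpace c d} (f : X ⇉ Y) where
  private
    module X = RepresentedSpace X
    module Y = RepresentedSpace Y

  ≤sW-^∞ : f ≤sW f ^∞
  ≤sW-^∞ = Excess.machine , Start.transducer , Excess.machine-computable excess-computable ,
         start-computable , λ G G⊢ p n x∈dom →
    let (e , _ , q , q0 , chain , o≗) = G⊢ (start p) tt (start-dom (f ʳ) p (n , x∈dom))
        (r , (n′ , m , v) , is)       = step-values (f ʳ) q0 (chain 0)
        q1≗ = IsSup-unique is (start-sup p r)
        o≡  = λ k → trans (o≗ (pair 1 (k + k)))
                (trans (cong (λ (i , j) → q i j) (unpair-pair 1 (k + k))) (q1≗ (k + k)))
    in ((((start p , Start.transduce start-causal p) , e) , r , excess-sup {p = p} o≡) ,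
        -- A value of `f ʳ` brings its own proof that `p` is a name, so it is moved from `n′` to
        -- `n`.
        m , _⇉_.values-resp f (X.δ-cong ≗-refl n′ n) (Setoid.refl Y.setoid) v)

-- Runs of the loop as points of a closed set

pair-unpair₃ : ∀ m → pair (proj₁ (unpair m)) (uncurry pair (unpair (proj₂ (unpair m)))) ≡ m
pair-unpair₃ m =
  trans (cong (pair (proj₁ (unpair m))) (pair-unpair (proj₂ (unpair m)))) (pair-unpair m)

-- A run is stored in y with row 0 for the states and row i + 1 for the answer xᵢ.  The symbol at
-- pos n k t tells whether o(n) = k, where o = ⟨q₀ , q₁ , …⟩ω; t is a dummy.
pos : ℕ → ℕ → ℕ → ℕ
pos n k t = pair 0 (pair n (pair k t))

indicator : ℕ → ℕ → ℕ
indicator e k = bit (e ≡ᵇ k)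

indicator-refl : ∀ e → indicator e e ≡ 1
indicator-refl e = cong bit (reflects-true (≡ᵇ-reflects e e) refl)

indicator-1 : ∀ e k → indicator e k ≡ 1 → e ≡ k
indicator-1 e k eq = reflects-proved (≡ᵇ-reflects e k) (bit-injective eq)

row : Baire → ℕ → Baire
row y i j = y (pair (suc i) j)

entry : Baire → (ℕ → Baire) → ℕ × ℕ → ℕ
entry o x (zero  , m) = indicator (o (proj₁ (unpair m))) (proj₁ (unpair (proj₂ (unpair m))))
entry o x (suc i , j) = x i j

layout : Baire → (ℕ → Baire) → Baire
layout o x m = entry o x (unpair m)

layout-pos : ∀ o x n k t → layout o x (pos n k t) ≡ indicator (o n) k
layout-pos o x n k t
  rewrite unpair-pair 0 (pair n (pair k t)) | unpair-pair n (pair k t) | unpair-pair k t = refl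

layout-row : ∀ o x i j → layout o x (pair (suc i) j) ≡ x i j
layout-row o x i j rewrite unpair-pair (suc i) j = refl

Encodes : Baire → Baire → Set
Encodes y o = ∀ n k t → y (pos n k t) ≡ indicator (o n) k

-- Row 0 has no spare positions, as every number has the form `pair n (pair k t)` and `Encodes`
-- covers all dummies `t`. A free position would destroy the uniqueness needed for `UC`.
layout-η : ∀ {y o} → Encodes y o → y ≗ layout o (row y)
layout-η {y} {o} enc m = trans (cong y (sym (pair-unpair m))) (go (unpair m))
  where
  go : ∀ ij → y (uncurry pair ij) ≡ entry o (row y) ij
  go (suc i , j) = refl
  go (zero  , m) = trans (cong (y ∘ pair 0) (sym (pair-unpair₃ m)))
    (enc (proj₁ (unpair m)) (proj₁ (unpair (proj₂ (unpair m)))) (proj₂ (unpair (proj₂ (unpair m)))))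

entry-cong : ∀ {o o′ x x′} → o ≗ o′ → (∀ i → x i ≗ x′ i) → entry o x ≗ entry o′ x′
entry-cong o≗ x≗ (zero  , m) = cong (λ e → indicator e _) (o≗ _)
entry-cong o≗ x≗ (suc i , j) = x≗ i j

≺-pad : ∀ {w r} → w ≺ r → ∀ {n} → n < length w → pad w n ≡ r n
≺-pad {w} {r} w≺r n< = subst (λ u → pad u _ ≡ r _) w≺r (pad-↾ r n<)

pad-≺ : ∀ w {r} → (∀ {n} → n < length w → r n ≡ pad w n) → w ≺ r
pad-≺ []      h = refl
pad-≺ (x ∷ w) h = cong₂ _∷_ (h z<s) (pad-≺ w (h ∘ s<s))

↾-≺ : ∀ (r : Baire) n → (r ↾ n) ≺ r
↾-≺ r n = cong (r ↾_) (length-applyUpTo r n)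

-- When the last symbol read is the 1 at position pos n k t, the symbol k is written.  No search is
-- necessary, since due to t this happens infinitely often for each n.
scan : List ℕ × ℕ → ℕ
scan (w , n) = if (proj₁ (unpair m) ≡ᵇ 0) ∧ (proj₁ (unpair a) ≡ᵇ n) ∧ (at w m ≡ᵇ 2)
               then suc (proj₁ (unpair (proj₂ (unpair a)))) else 0
  where
  m = pred (length w)
  a = proj₂ (unpair m)

module Scan = Machine scan

scan-computable : Computable scan
scan-computable = ifᶜ
  (isZeroᶜ (fstᶜ (unpairᶜ m)) ∧ᶜ (fstᶜ (unpairᶜ a) ≡ᵇᶜ sndᶜ varᶜ)
   ∧ᶜ (atᶜ (fstᶜ varᶜ) m ≡ᵇᶜ constᶜ 2))
  (sucᶜ (fstᶜ (unpairᶜ (sndᶜ (unpairᶜ a))))) (constᶜ 0)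
  where
  m = predᶜ (lengthᶜ (fstᶜ varᶜ))
  a = sndᶜ (unpairᶜ m)

at-↾ : ∀ (y : Baire) m n {v} → at (y ↾ m) n ≡ suc v → y n ≡ v
at-↾ y m n eq with n <? m
... | yes n<m = suc-injective (trans (sym (at-applyUpTo y n<m)) eq)
... | no n≮m  = contradiction
  (trans (sym eq) (at-length (y ↾ m) (subst (_≤ n) (sym (length-applyUpTo y m)) (≮⇒≥ n≮m)))) λ ()

scan-sup : ∀ {y o} → Encodes y o → IsSup Scan.output y o
scan-sup {y} {o} enc = Scan.isSup {y} {o} sound complete
  where
  complete : ∀ n m → ∃ λ k → m ≤ k × ∃ λ v → scan (y ↾ k , n) ≡ suc v
  -- Taking `m` as the dummy puts the position `P` at or beyond `m`; the prefix of length `suc P`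
  -- ends exactly with the symbol there.
  complete n m = suc P ,
    m≤n⇒m≤1+n (≤-trans (j≤pair (o n) m) (≤-trans (j≤pair n _) (j≤pair 0 _))) , o n , eq
    where
    P = pos n (o n) m
    eq : scan (y ↾ suc P , n) ≡ suc (o n)
    eq rewrite length-applyUpTo (y ∘ suc) P
      | unpair-pair 0 (pair n (pair (o n) m)) | unpair-pair n (pair (o n) m)
      | unpair-pair (o n) m | reflects-true (≡ᵇ-reflects n n) refl
      | at-applyUpTo y (≤-refl {suc P}) | enc n (o n) m | indicator-refl (o n) = refl

  sound : ∀ m n {v} → scan (y ↾ m , n) ≡ suc v → v ≡ o n
  sound m n {v} eq = go _ _ _ (≡ᵇ-reflects _ _) (≡ᵇ-reflects _ _) (≡ᵇ-reflects _ _) eq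
    where
    l = pred (length (y ↾ m))
    a = proj₂ (unpair l)
    k = proj₁ (unpair (proj₂ (unpair a)))
    t = proj₂ (unpair (proj₂ (unpair a)))
    go : ∀ b₁ b₂ b₃ → Reflects (proj₁ (unpair l) ≡ 0) b₁ → Reflects (proj₁ (unpair a) ≡ n) b₂ →
         Reflects (at (y ↾ m) l ≡ 2) b₃ → (if b₁ ∧ b₂ ∧ b₃ then suc k else 0) ≡ suc v → v ≡ o n
    go true true true (ofʸ l₁) (ofʸ a₁) (ofʸ y₁) refl = sym (indicator-1 (o n) k
      (trans (sym (enc n k t)) (trans (cong y l≡) (at-↾ y m l y₁))))
      where
      l≡ : pos n k t ≡ l
      l≡ = trans (cong₂ (λ i j → pair i (pair j (pair k t))) (sym l₁) (sym a₁))
        (trans (cong (pair (proj₁ (unpair l))) (pair-unpair₃ a)) (pair-unpair l))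
    go true  true  false _ _ _ ()
    go true  false _     _ _ _ ()
    go false _     _     _ _ _ ()

-- (i , c , v , j , k , t) stands for all tests on the i-th round with these parameters, where c is
-- the code of a prefix of xᵢ.
Test : Set
Test = ℕ × ℕ × ℕ × ℕ × ℕ × ℕ

split : {X : Set} → (ℕ → X) → ℕ → ℕ × X
split f m = proj₁ (unpair m) , f (proj₂ (unpair m))

toTest : ℕ → Test
toTest = split (split (split (split unpair)))

toTest-enc : ∀ τ → toTest (enc τ) ≡ τ
toTest-enc (i , c , v , j , k , t)
  rewrite unpair-pair i (pair c (pair v (pair j (pair k t))))
        | unpair-pair c (pair v (pair j (pair k t)))
        | unpair-pair v (pair j (pair k t)) | unpair-pair j (pair k t) | unpair-pair k t = refl

toTestᶜ : Computable toTest
toTestᶜ = splitᶜ (splitᶜ (splitᶜ (splitᶜ (unpairᶜ varᶜ))))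
  where
  splitᶜ : {X : Set} ⦃ _ : Coded X ⦄ {f : ℕ → X} → Computable f → Computable (split f)
  splitᶜ cf = fstᶜ (unpairᶜ varᶜ) ,ᶜ cf $ᶜ sndᶜ (unpairᶜ varᶜ)

index : Test → ℕ
index (_ , _ , _ , j , _) = j

index≤ : ∀ m → index (toTest m) ≤ m
index≤ m = ≤-trans (fst≤ _) (≤-trans (snd≤ _) (≤-trans (snd≤ _) (snd≤ m)))
  where
  fst≤ : ∀ m → proj₁ (unpair m) ≤ m
  fst≤ m = subst (proj₁ (unpair m) ≤_) (pair-unpair m) (i≤pair _ (proj₂ (unpair m)))
  snd≤ : ∀ m → proj₂ (unpair m) ≤ m
  snd≤ m = subst (proj₂ (unpair m) ≤_) (pair-unpair m) (j≤pair (proj₁ (unpair m)) _)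

-- The predicates on a partial sequence a use the convention of at: 0 means undefined.
Matches : (ℕ → ℕ) → ℕ → List ℕ → Set
Matches a i w = ∀ j → j < length w → a (pair (suc i) j) ≡ at w j

Says : (ℕ → ℕ) → ℕ → ℕ → Set
Says a n v = a (pos n v 0) ≡ 2

Wrong : (ℕ → ℕ) → ℕ → ℕ → ℕ → ℕ → Set
Wrong a n e k t = ¬ a (pos n k t) ≡ 0 × ¬ a (pos n k t) ≡ suc (indicator e k)

matches : (ℕ → ℕ) → ℕ → List ℕ → Bool
matches a i w = allBelow (length w) λ j → a (pair (suc i) j) ≡ᵇ at w j

says : (ℕ → ℕ) → ℕ → ℕ → Bool
says a n v = a (pos n v 0) ≡ᵇ 2

wrong : (ℕ → ℕ) → ℕ → ℕ → ℕ → ℕ → Bool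
wrong a n e k t = not (a (pos n k t) ≡ᵇ 0) ∧ not (a (pos n k t) ≡ᵇ suc (indicator e k))

-- forbidden (n , v , c) means that an input p with p(n) = v excludes the answers with prefix
-- decode c.
module Constraints (forbidden : ℕ × ℕ × ℕ → Bool) where

  -- The three cases refute the initial state, where e = q₀(j), the answer xᵢ, and the transition
  -- to qᵢ₊₁, where v = evens qᵢ (c) is the code of a prefix of qᵢ₊₁.
  Violates : ℕ → (ℕ → ℕ) → Test → Set
  Violates e a (i , c , v , j , k , t) =
    Wrong a (pair 0 j) e k t
    ⊎ (Matches a i (decode c) × Says a (pair i (suc (j + j))) v × T (forbidden (j , v , c)))
    ⊎ (Matches a i (decode c) × Says a (pair i (c + c)) v × j < length (decode v)
       × Wrong a (pair (suc i) j) (pad (decode v) j) k t)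

  violates : ℕ → (ℕ → ℕ) → Test → Bool
  violates e a (i , c , v , j , k , t) =
    wrong a (pair 0 j) e k t
    ∨ (matches a i (decode c) ∧ says a (pair i (suc (j + j))) v ∧ forbidden (j , v , c))
    ∨ (matches a i (decode c) ∧ says a (pair i (c + c)) v ∧ (j <ᵇ length (decode v))
       ∧ wrong a (pair (suc i) j) (pad (decode v) j) k t)

  violates-reflects : ∀ e a τ → Reflects (Violates e a τ) (violates e a τ)
  violates-reflects e a (i , c , v , j , k , t) =
    wrong-reflects (pair 0 j) e
    ⊎-reflects (matches-reflects ×-reflects ≡ᵇ-reflects _ _ ×-reflects T-reflects _)
    ⊎-reflects (matches-reflects ×-reflects ≡ᵇ-reflects _ _ ×-reflects <ᵇ-reflects-< _ _
                ×-reflects wrong-reflects (pair (suc i) j) (pad (decode v) j))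
    where
    matches-reflects : Reflects (Matches a i (decode c)) (matches a i (decode c))
    matches-reflects = allBelow-reflects (λ j → ≡ᵇ-reflects _ _) (length (decode c))
    wrong-reflects : ∀ n e → Reflects (Wrong a n e k t) (wrong a n e k t)
    wrong-reflects n e = ¬-reflects (≡ᵇ-reflects _ _) ×-reflects ¬-reflects (≡ᵇ-reflects _ _)

  -- A word undergoes only the tests whose number is below its length. This keeps badness decidable
  -- and, by `index≤`, dependent on equally many symbols of `q` only; every test still takes place
  -- on long prefixes.
  bad : Baire → List ℕ → Bool
  bad q u = anyBelow (length u) λ m → violates (q (index (toTest m))) (at u) (toTest m)

  Bad : Baire → List ℕ → Set
  Bad q u = ∃ λ m → m < length u × Violates (q (index (toTest m))) (at u) (toTest m)

  bad-reflects : ∀ q u → Reflects (Bad q u) (bad q u)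
  bad-reflects q u = anyBelow-reflects
    (λ m → violates-reflects (q (index (toTest m))) (at u) (toTest m)) (length u)

  bad-local : ∀ {p q} u → (∀ {k} → k < length u → p k ≡ q k) → bad p u ≡ bad q u
  bad-local u p≡q = natrec-local (length u) λ {m} m< b →
    cong (λ e → violates e (at u) (toTest m) ∨ b) (p≡q (≤-<-trans (index≤ m) m<))

  badᶜ : Computable forbidden → {Γ : Set} ⦃ _ : Coded Γ ⦄ {q u : Γ → List ℕ} →
         Computable q → Computable u → Computable (λ γ → bad (pad (q γ)) (u γ))
  badᶜ forbiddenᶜ cq cu = anyBelowᶜ (lengthᶜ cu)
    (violatesᶜ $ᶜ (padᶜ (cq $ᶜ fstᶜ varᶜ) (indexᶜ $ᶜ (toTestᶜ $ᶜ sndᶜ varᶜ))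
                  ,ᶜ cu $ᶜ fstᶜ varᶜ ,ᶜ toTestᶜ $ᶜ sndᶜ varᶜ))
    where
    module _ {Γ : Set} ⦃ _ : Coded Γ ⦄ {u : Γ → List ℕ} (cu : Computable u) where

      posᶜ : {n k t : Γ → ℕ} → Computable n → Computable k → Computable t →
             Computable (λ γ → pos (n γ) (k γ) (t γ))
      posᶜ cn ck ct = pairᶜ (constᶜ 0) (pairᶜ cn (pairᶜ ck ct))

      saysᶜ : {n v : Γ → ℕ} → Computable n → Computable v →
              Computable (λ γ → says (at (u γ)) (n γ) (v γ))
      saysᶜ cn cv = atᶜ cu (posᶜ cn cv (constᶜ 0)) ≡ᵇᶜ constᶜ 2

      wrongᶜ : {n e k t : Γ → ℕ} → Computable n → Computable e → Computable k → Computable t →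
               Computable (λ γ → wrong (at (u γ)) (n γ) (e γ) (k γ) (t γ))
      wrongᶜ cn ce ck ct = notᶜ (isZeroᶜ (atᶜ cu (posᶜ cn ck ct)))
        ∧ᶜ notᶜ (atᶜ cu (posᶜ cn ck ct) ≡ᵇᶜ sucᶜ (bitᶜ (ce ≡ᵇᶜ ck)))

      matchesᶜ : {i : Γ → ℕ} {w : Γ → List ℕ} → Computable i → Computable w →
                 Computable (λ γ → matches (at (u γ)) (i γ) (w γ))
      matchesᶜ ci cw = allBelowᶜ (lengthᶜ cw)
        (atᶜ (cu $ᶜ fstᶜ varᶜ) (pairᶜ (sucᶜ (ci $ᶜ fstᶜ varᶜ)) (sndᶜ varᶜ))
         ≡ᵇᶜ atᶜ (cw $ᶜ fstᶜ varᶜ) (sndᶜ varᶜ))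

    indexᶜ : Computable index
    indexᶜ = fstᶜ (sndᶜ (sndᶜ (sndᶜ varᶜ)))

    violatesᶜ : Computable (λ ((e , u , τ) : ℕ × List ℕ × Test) → violates e (at u) τ)
    violatesᶜ = wrongᶜ u (pairᶜ (constᶜ 0) j) (fstᶜ varᶜ) k t
      ∨ᶜ (matchesᶜ u i (decodeᶜ c) ∧ᶜ saysᶜ u (pairᶜ i (sucᶜ (j +ᶜ j))) v
          ∧ᶜ forbiddenᶜ $ᶜ (j ,ᶜ v ,ᶜ c))
      ∨ᶜ (matchesᶜ u i (decodeᶜ c) ∧ᶜ saysᶜ u (pairᶜ i (c +ᶜ c)) v ∧ᶜ (j <ᵇᶜ lengthᶜ (decodeᶜ v))
          ∧ᶜ wrongᶜ u (pairᶜ (sucᶜ i) j) (padᶜ (decodeᶜ v) j) k t)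
      where
      u = fstᶜ (sndᶜ varᶜ)
      τ = sndᶜ (sndᶜ varᶜ)
      i = fstᶜ τ
      c = fstᶜ (sndᶜ τ)
      v = fstᶜ (sndᶜ (sndᶜ τ))
      j = fstᶜ (sndᶜ (sndᶜ (sndᶜ τ)))
      k = fstᶜ (sndᶜ (sndᶜ (sndᶜ (sndᶜ τ))))
      t = sndᶜ (sndᶜ (sndᶜ (sndᶜ (sndᶜ τ))))

  module _ {a b : ℕ → ℕ} (a⊑b : ∀ n {v} → a n ≡ suc v → b n ≡ suc v) where

    defined : ∀ n → ¬ a n ≡ 0 → a n ≡ b n
    defined n a≢0 with a n in eq
    ... | zero  = contradiction refl a≢0
    ... | suc v = sym (a⊑b n eq)

    -- Each clause asserts that the entries it uses are defined, `Wrong` by its first half, so a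
    -- violation persists when more of the sequence is known. This is why the tree for `WKL` is
    -- closed under prefixes.
    violates-mono : ∀ e τ → Violates e a τ → Violates e b τ
    violates-mono e (i , c , v , j , k , t) = Sum.map (wrong-mono (pair 0 j) e) (Sum.map
      (λ (m , s , f) → matches-mono m , a⊑b (pos (pair i (suc (j + j))) v 0) s , f)
      (λ (m , s , j< , w) → matches-mono m , a⊑b (pos (pair i (c + c)) v 0) s , j< ,
        wrong-mono (pair (suc i) j) (pad (decode v) j) w))
      where
      wrong-mono : ∀ n e → Wrong a n e k t → Wrong b n e k t
      wrong-mono n e (≢0 , ≢s) =
        subst (λ x → ¬ x ≡ 0 × ¬ x ≡ suc (indicator e k)) (defined (pos n k t) ≢0) (≢0 , ≢s)
      matches-mono : Matches a i (decode c) → Matches b i (decode c)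
      matches-mono m j j< =
        trans (a⊑b (pair (suc i) j) (trans (m j j<) (at-suc (decode c) j<))) (sym (at-suc (decode c) j<))

  bad-mono : ∀ q {u v} → u ⊑ v → Bad q u → Bad q v
  bad-mono q {u} {v} u⊑v (m , m< , viol) =
    m , <-≤-trans m< (Prefixₚ.length-mono u⊑v) ,
    violates-mono at-mono (q (index (toTest m))) (toTest m) viol
    where
    at-mono : ∀ n {x} → at u n ≡ suc x → at v n ≡ suc x
    at-mono n eq with n <? length u
    ... | yes n< = trans (sym (⊑-at u⊑v n<)) eq
    ... | no n≮  = contradiction (trans (sym (at-length u (≮⇒≥ n≮))) eq) λ ()

  -- What the tests amount to for a total sequence. Apart from `starts`, all conditions depend on
  -- what `y` itself asserts about a state, so nothing here says that later states have values.
  record Consistent (q y : Baire) : Set where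
    field
      starts  : ∀ j k t → y (pos (pair 0 j) k t) ≡ indicator (q j) k
      allowed : ∀ i w j v → w ≺ row y i → y (pos (pair i (suc (j + j))) v 0) ≡ 1 →
                ¬ T (forbidden (j , v , code w))
      steps   : ∀ i w v j k t → w ≺ row y i → y (pos (pair i (code w + code w)) v 0) ≡ 1 →
                j < length (decode v) →
                y (pos (pair (suc i) j) k t) ≡ indicator (pad (decode v) j) k

  module _ {q y : Baire} where

    consistent⇒good : Consistent q y → ∀ m → bad q (y ↾ m) ≡ false
    consistent⇒good con m =
      reflects-false (bad-reflects q (y ↾ m)) λ (l , _ , viol) → go (toTest l) viol
      where
      open Consistent con
      a = at (y ↾ m)

      correct : ∀ n e k t → y (pos n k t) ≡ indicator e k → ¬ Wrong a n e k t
      correct n e k t eq (≢0 , ≢s) with a (pos n k t) in aeq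
      ... | zero  = ≢0 refl
      ... | suc x = ≢s (cong suc (trans (sym (at-↾ y m _ aeq)) eq))

      matched : ∀ i w → Matches a i w → w ≺ row y i
      matched i w mat = pad-≺ w λ {n} n< → at-↾ y m _ (trans (mat n n<) (at-suc w n<))

      go : ∀ τ → ¬ Violates (q (index τ)) a τ
      go (i , c , v , j , k , t) (inj₁ w) = correct (pair 0 j) (q j) k t (starts j k t) w
      go (i , c , v , j , k , t) (inj₂ (inj₁ (mat , s , f))) =
        allowed i (decode c) j v (matched i (decode c) mat) (at-↾ y m _ s)
          (subst (λ c → T (forbidden (j , v , c))) (sym (code-decode c)) f)
      go (i , c , v , j , k , t) (inj₂ (inj₂ (mat , s , j< , w))) =
        correct (pair (suc i) j) (pad (decode v) j) k t
          (steps i (decode c) v j k t (matched i (decode c) mat)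
            (subst (λ c → y (pos (pair i (c + c)) v 0) ≡ 1) (sym (code-decode c))
              (at-↾ y m _ s)) j<) w

    module _ (good : ∀ m → bad q (y ↾ m) ≡ false) where

      refute : ∀ {m l τ} → toTest l ≡ τ → l < m → ¬ Violates (q (index τ)) (at (y ↾ m)) τ
      refute {m} {l} refl l<m viol = reflects-refuted (bad-reflects q (y ↾ m)) (good m)
        (l , subst (l <_) (sym (length-applyUpTo y m)) l<m , viol)

      wrong-seen : ∀ m n e k t → pos n k t < m → ¬ y (pos n k t) ≡ indicator e k →
                   Wrong (at (y ↾ m)) n e k t
      wrong-seen m n e k t <m ≢ind rewrite at-applyUpTo y <m = (λ ()) , ≢ind ∘ suc-injective

      says-seen : ∀ m n v → pos n v 0 < m → y (pos n v 0) ≡ 1 → Says (at (y ↾ m)) n v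
      says-seen m n v <m eq = trans (at-applyUpTo y <m) (cong suc eq)

      pair-monoʳ : ∀ i {j k} → j ≤ k → pair i j ≤ pair i k
      pair-monoʳ i j≤k = +-mono-≤ (triangle-mono-≤ (+-monoʳ-≤ i j≤k)) j≤k

      matches-seen : ∀ m i w → pair (suc i) (length w) < m → w ≺ row y i → Matches (at (y ↾ m)) i w
      matches-seen m i w <m w≺ j j< =
        trans (at-applyUpTo y (≤-<-trans (pair-monoʳ (suc i) (<⇒≤ j<)) <m))
              (trans (cong suc (sym (≺-pad w≺ j<))) (sym (at-suc w j<)))

      -- A failure shows in every prefix that is longer than the number of the test and the
      -- positions read by it, hence the maxima `m`. As equality of numbers is decidable, `starts`
      -- and `steps` may be proved by refutation.
      good⇒consistent : Consistent q y
      good⇒consistent = record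
        { starts  = starts
        ; allowed = allowed
        ; steps   = steps
        }
        where
        starts : ∀ j k t → y (pos (pair 0 j) k t) ≡ indicator (q j) k
        starts j k t with y (pos (pair 0 j) k t) ≟ indicator (q j) k
        ... | yes eq = eq
        ... | no ≢ind = contradiction
          (inj₁ (wrong-seen m (pair 0 j) (q j) k t (s≤s (m≤n⊔m (enc τ) P)) ≢ind))
          (refute (toTest-enc τ) (s≤s (m≤m⊔n (enc τ) P)))
          where
          τ = 0 , 0 , 0 , j , k , t
          P = pos (pair 0 j) k t
          m = suc (enc τ ⊔ P)

        allowed : ∀ i w j v → w ≺ row y i → y (pos (pair i (suc (j + j))) v 0) ≡ 1 →
                  ¬ T (forbidden (j , v , code w))
        allowed i w j v w≺ eq f = refute (toTest-enc τ) (s≤s (m≤m⊔n (enc τ) _)) (inj₂ (inj₁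
          (subst (Matches (at (y ↾ m)) i) (sym (decode-code w))
             (matches-seen m i w (s≤s (≤-trans (m≤m⊔n R P) (m≤n⊔m (enc τ) _))) w≺) ,
           says-seen m (pair i (suc (j + j))) v
             (s≤s (≤-trans (m≤n⊔m R P) (m≤n⊔m (enc τ) _))) eq , f)))
          where
          τ = i , code w , v , j , 0 , 0
          P = pos (pair i (suc (j + j))) v 0
          R = pair (suc i) (length w)
          m = suc (enc τ ⊔ (R ⊔ P))

        steps : ∀ i w v j k t → w ≺ row y i → y (pos (pair i (code w + code w)) v 0) ≡ 1 →
                j < length (decode v) →
                y (pos (pair (suc i) j) k t) ≡ indicator (pad (decode v) j) k
        steps i w v j k t w≺ eq j<
          with y (pos (pair (suc i) j) k t) ≟ indicator (pad (decode v) j) k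
        ... | yes eq′ = eq′
        ... | no ≢ind = contradiction (inj₂ (inj₂
          (subst (Matches (at (y ↾ m)) i) (sym (decode-code w))
             (matches-seen m i w (s≤s (≤-trans (m≤m⊔n R (P ⊔ Q)) (m≤n⊔m (enc τ) _))) w≺) ,
           says-seen m (pair i (code w + code w)) v
             (s≤s (≤-trans (m≤m⊔n P Q) (≤-trans (m≤n⊔m R (P ⊔ Q)) (m≤n⊔m (enc τ) _)))) eq , j< ,
           wrong-seen m (pair (suc i) j) (pad (decode v) j) k t
             (s≤s (≤-trans (m≤n⊔m P Q) (≤-trans (m≤n⊔m R (P ⊔ Q)) (m≤n⊔m (enc τ) _)))) ≢ind)))
          (refute (toTest-enc τ) (s≤s (m≤m⊔n (enc τ) _)))
          where
          τ = i , code w , v , j , k , t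
          P = pos (pair i (code w + code w)) v 0
          Q = pos (pair (suc i) j) k t
          R = pair (suc i) (length w)
          m = suc (enc τ ⊔ (R ⊔ (P ⊔ Q)))

-- Runs with explicit answers and their relation to consistent sequences

record Chain (g : baire ⇉ baire) (q₀ : Baire) (q x : ℕ → Baire) : Set where
  open _⇉_ g
  field
    initial : q 0 ≗ q₀
    defined : ∀ i → dom (odds (q i))
    answers : ∀ i → values (odds (q i)) (x i)
    results : ∀ i → IsSup (wordFunction (evens (q i))) (x i) (q (suc i))

step-sup : ∀ g q {x} → _⇉_.dom (step g) q → _⇉_.values g (odds q) x →
           ∃ λ r → IsSup (wordFunction (evens q)) x r
step-sup g q {x} (_ , U-dom) v =
  let (r , is) = U-dom ⟨ evens q , x ⟩ (x , v , ≗-refl)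
  in r , IsSup-resp (wordFunction-resp (evens-⟨,⟩ (evens q) x)) (odds-⟨,⟩ (evens q) x) ≗-refl is

module Chains (g : baire ⇉ baire) where
  open _⇉_ g

  chain-step : ∀ {q₀ q x} → Chain g q₀ q x → ∀ i → _⇉_.values (step g) (q i) (q (suc i))
  chain-step {q = q} chain i = step-intro g (≗-sym (⟨evens,odds⟩ (q i))) (answers i) (results i)
    where open Chain chain

  chain-values : ∀ {q₀ q x} → Chain g q₀ q x → _⇉_.values (loop g) q₀ ⟨ q ⟩ω
  chain-values {q = q} chain = q , Chain.initial chain , chain-step chain , ≗-refl

  -- As `choose` is a function, plain recursion replaces dependent choice. Each state is kept with
  -- its membership in `A`, from which `q₀∈dom` derives that the next step is defined.
  chain-exists : (∀ p → dom p → ∃ (values p)) → ∀ {q₀} → _⇉_.dom (loop g) q₀ →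
                 ∃ λ q → ∃ λ x → Chain g q₀ q x
  chain-exists choose {q₀} q₀∈dom = (λ i → proj₁ (states i)) , (λ i → proj₁ (answer i)) , record
    { initial = ≗-refl
    ; defined = λ i → proj₁ (step∈dom i)
    ; answers = λ i → proj₂ (answer i)
    ; results = λ i → proj₂ (result i)
    }
    where
    states : ∀ i → ∃ (A g q₀ i)
    step∈dom : ∀ i → _⇉_.dom (step g) (proj₁ (states i))
    answer : ∀ i → ∃ (values (odds (proj₁ (states i))))
    result : ∀ i → ∃ (IsSup (wordFunction (evens (proj₁ (states i)))) (proj₁ (answer i)))

    step∈dom i = q₀∈dom i _ (proj₂ (states i))
    answer i = choose (odds (proj₁ (states i))) (proj₁ (step∈dom i))
    result i = step-sup g (proj₁ (states i)) (step∈dom i) (proj₂ (answer i))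
    states zero    = q₀ , ≗-refl
    states (suc i) = proj₁ (result i) , proj₁ (states i) , proj₂ (states i) ,
      step-intro g (≗-sym (⟨evens,odds⟩ (proj₁ (states i)))) (proj₂ (answer i)) (proj₂ (result i))

  module _ (single-valued : ∀ {p x x′} → dom p → values p x → values p x′ → x ≗ x′)
           {q₀ q x q′ x′} (chain : Chain g q₀ q x) (chain′ : Chain g q₀ q′ x′) where
    private
      module c = Chain chain
      module c′ = Chain chain′

    answers-≗ : ∀ {i} → q i ≗ q′ i → x i ≗ x′ i
    answers-≗ {i} q≗ = single-valued (c.defined i) (c.answers i)
      (values-resp (λ n → sym (q≗ (suc (n + n)))) ≗-refl (c′.answers i))

    states-≗ : ∀ i → q i ≗ q′ i
    states-≗ zero    = ≗-trans c.initial (≗-sym c′.initial)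
    states-≗ (suc i) = IsSup-unique (IsSup-resp (wordFunction-resp (λ n → states-≗ i (n + n)))
      (answers-≗ (states-≗ i)) ≗-refl (c.results i)) (c′.results i)

    chain-unique : layout ⟨ q ⟩ω x ≗ layout ⟨ q′ ⟩ω x′
    chain-unique m = entry-cong (λ n → states-≗ (proj₁ (unpair n)) (proj₂ (unpair n)))
                                (λ i → answers-≗ (states-≗ i)) (unpair m)

  -- All that is needed of the problem: on its domain, a named sequence is a correct answer iff no
  -- single symbol of the input excludes one of its prefixes. Closed choice and `WKL` are the
  -- instances `listed` and `pruned`.
  module Solutions (forbidden : ℕ × ℕ × ℕ → Bool) (Name : Baire → Set)
    (name      : ∀ {p x} → values p x → Name x)
    (respects  : ∀ p {x} → values p x → ∀ w n → w ≺ x → ¬ T (forbidden (n , p n , code w)))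
    (respected : ∀ p {x} → dom p → Name x →
                 (∀ w n → w ≺ x → ¬ T (forbidden (n , p n , code w))) → values p x)
    where

    open Constraints forbidden

    chain⇒consistent : ∀ {q₀ q x} → Chain g q₀ q x → Consistent q₀ (layout ⟨ q ⟩ω x)
    chain⇒consistent {q₀} {q} {x} chain = record
      { starts  = λ j k t → trans (encodes 0 j k t) (cong (λ e → indicator e k) (initial j))
      ; allowed = λ i w j v w≺ eq f → respects (odds (q i)) (answers i) w j (row-≺ i w≺)
          (subst (λ v → T (forbidden (j , v , code w))) (sym (reads i _ v eq)) f)
      ; steps   = λ i w v j k t w≺ eq j< → trans (encodes (suc i) j k t)
          (cong (λ e → indicator e k) (sym (≺-pad
            (subst (λ v → decode v ≺ q (suc i)) (reads i _ v eq)
              (subst (λ w → decode (q i (code w + code w)) ≺ q (suc i)) (row-≺ i w≺)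
                (IsSup.bound (results i) (length w)))) j<)))
      }
      where
      open Chain chain
      y = layout ⟨ q ⟩ω x

      encodes : ∀ i j k t → y (pos (pair i j) k t) ≡ indicator (q i j) k
      encodes i j k t = trans (layout-pos ⟨ q ⟩ω x (pair i j) k t)
        (cong (λ (i , j) → indicator (q i j) k) (unpair-pair i j))

      reads : ∀ i j v → y (pos (pair i j) v 0) ≡ 1 → q i j ≡ v
      reads i j v eq = indicator-1 (q i j) v (trans (sym (encodes i j v 0)) eq)

      row-≺ : ∀ i {w} → w ≺ row y i → w ≺ x i
      row-≺ i = ≺-resp (layout-row ⟨ q ⟩ω x i)

    module _ {q₀ y} (q₀∈dom : _⇉_.dom (loop g) q₀) (consistent : Consistent q₀ y)
             (names : ∀ i → Name (row y i)) where
      open Consistent consistent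

      EncodesState : ℕ → Baire → Set
      EncodesState i q = ∀ j k t → y (pos (pair i j) k t) ≡ indicator (q j) k

      row-answers : ∀ i q → dom (odds q) → EncodesState i q → values (odds q) (row y i)
      row-answers i q d enc = respected (odds q) d (names i) λ w n w≺ →
        allowed i w n (q (suc (n + n))) w≺
          (trans (enc (suc (n + n)) (q (suc (n + n))) 0) (indicator-refl (q (suc (n + n)))))

      -- Some prefix `w` of the answer makes the table produce more than `j` symbols. Since `y`
      -- encodes `q` correctly, it asserts the table entry at `w`, and `steps` then forces all bits
      -- about position `j`.
      encodes-result : ∀ i q {r} → EncodesState i q → IsSup (wordFunction (evens q)) (row y i) r →
                       EncodesState (suc i) r
      encodes-result i q enc is j k t =
        let (n , j<) = IsSup.unbounded is (suc j)
            w        = row y i ↾ n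
        in trans (steps i w (q (code w + code w)) j k t (↾-≺ (row y i) n)
                   (trans (enc (code w + code w) (q (code w + code w)) 0)
                          (indicator-refl (q (code w + code w)))) j<)
                 (cong (λ e → indicator e k) (≺-pad (IsSup.bound is n) j<))

      -- The states are not read off `y` but computed from `q₀` and the answer rows. That `y`
      -- encodes them must be carried along, because the correctness of the next answer rests on it.
      states : ∀ i → Σ (∃ (A g q₀ i)) (EncodesState i ∘ proj₁)
      step∈dom : ∀ i → _⇉_.dom (step g) (proj₁ (proj₁ (states i)))
      answer : ∀ i → values (odds (proj₁ (proj₁ (states i)))) (row y i)
      result : ∀ i → ∃ (IsSup (wordFunction (evens (proj₁ (proj₁ (states i))))) (row y i))

      step∈dom i = q₀∈dom i _ (proj₂ (proj₁ (states i)))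
      answer i = row-answers i (proj₁ (proj₁ (states i))) (proj₁ (step∈dom i)) (proj₂ (states i))
      result i = step-sup g (proj₁ (proj₁ (states i))) (step∈dom i) (answer i)
      states zero    = (q₀ , ≗-refl) , starts
      states (suc i) = (proj₁ (result i) , proj₁ (proj₁ (states i)) , proj₂ (proj₁ (states i)) ,
        step-intro g (≗-sym (⟨evens,odds⟩ (proj₁ (proj₁ (states i))))) (answer i)
          (proj₂ (result i))) ,
        encodes-result i (proj₁ (proj₁ (states i))) (proj₂ (states i)) (proj₂ (result i))

      consistent⇒chain : ∃ λ q → Chain g q₀ q (row y) × Encodes y ⟨ q ⟩ω
      consistent⇒chain = (λ i → proj₁ (proj₁ (states i))) , record
        { initial = ≗-refl
        ; defined = λ i → proj₁ (step∈dom i)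
        ; answers = answer
        ; results = λ i → proj₂ (result i)
        } , λ n k t → trans (cong (λ n → y (pos n k t)) (sym (pair-unpair n)))
                            (proj₂ (states (proj₁ (unpair n))) (proj₂ (unpair n)) k t)

-- Closed choice

listed : ℕ × ℕ × ℕ → Bool
listed (_ , v , c) = v ≡ᵇ suc c

listedᶜ : Computable listed
listedᶜ = fstᶜ (sndᶜ varᶜ) ≡ᵇᶜ sucᶜ (sndᶜ (sndᶜ varᶜ))

-- Every number codes a word, so that suc n lists the cylinder of decode n.
conflicts : Baire → Baire
conflicts q n = if Constraints.bad listed q (decode n) then suc n else 0

-- The word with code `n` has length at most `n`, so only symbols of the input before `n` are
-- inspected.
conflicts-causal : Causal conflicts
conflicts-causal n p≡q = cong (λ b → if b then suc n else 0)
  (Constraints.bad-local listed (decode n) λ k< → p≡q (<⇒≤ (<-≤-trans k< (length-decode≤ n))))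

module Conflicts = Transducer conflicts

conflicts-computable : IsComputable Conflicts.transducer
conflicts-computable = Conflicts.transducer-computable
  (ifᶜ (Constraints.badᶜ listed listedᶜ (fstᶜ varᶜ) (decodeᶜ (sndᶜ varᶜ)))
       (sucᶜ (sndᶜ varᶜ)) (constᶜ 0))

module ClosedChoice (X : SequenceSpace) (F : A₋ X ⇉ SequenceSpace.space X)
  (sequence-δ : ∀ {p} (m : SequenceSpace.Name X p) →
                SequenceSpace.sequence X (SequenceSpace.δ X p m) ≗ p)
  (row-name : ∀ {y} → SequenceSpace.Name X y → ∀ i → SequenceSpace.Name X (row y i))
  (layout-name : ∀ {o x} → (∀ i → SequenceSpace.Name X (x i)) → SequenceSpace.Name X (layout o x))
  (inhabited : ∀ {B} → _⇉_.dom F B → ∃ (proj₁ B))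
  (sound : ∀ {B x} → _⇉_.values F B x → proj₁ B x)
  (complete : ∀ {B x} → _⇉_.dom F B → proj₁ B x → _⇉_.values F B x)
  where

  private
    module X = SequenceSpace X
    module F = _⇉_ F

  g : baire ⇉ baire
  g = F ʳ

  respects : ∀ p {x} → _⇉_.values g p x → ∀ w n → w ≺ x → ¬ T (listed (n , p n , code w))
  respects p (_ , m , v) w n w≺ t =
    sound v n w (≡ᵇ⇒≡ (p n) _ t) (≺-resp (≗-sym (sequence-δ m)) w≺)

  respected : ∀ p {x} → _⇉_.dom g p → X.Name x →
              (∀ w n → w ≺ x → ¬ T (listed (n , p n , code w))) → _⇉_.values g p x
  respected p (_ , d) m h = tt , m , complete d λ n w eq w≺ →
    h w n (≺-resp (sequence-δ m) w≺) (≡⇒≡ᵇ (p n) _ eq)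

  open Constraints listed
  open Chains g
  open Solutions listed X.Name (λ (_ , m , _) → m) respects respected

  outside⇒good : ∀ q {x} → Outside X (conflicts q) x → ∀ m → bad q (X.sequence x ↾ m) ≡ false
  outside⇒good q {x} out m with bad q (X.sequence x ↾ m) in eq
  ... | false = refl
  ... | true  = contradiction (↾-≺ (X.sequence x) m) (out (code w) w
    (cong (λ b → if b then suc (code w) else 0) (trans (cong (bad q) (decode-code w)) eq)))
    where w = X.sequence x ↾ m

  good⇒outside : ∀ q {x} → (∀ m → bad q (X.sequence x ↾ m) ≡ false) → Outside X (conflicts q) x
  good⇒outside q {x} good n w eq w≺ with bad q (decode n) in bad≡
  good⇒outside q {x} good n w refl w≺ | true =
    contradiction (trans (sym bad≡)
      (trans (cong (bad q) (trans (decode-code w) (sym w≺))) (good (length w)))) λ ()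
  good⇒outside q {x} good n w () w≺ | false

  outside⇒consistent : ∀ {q y} (m : X.Name y) → Outside X (conflicts q) (X.δ y m) → Consistent q y
  outside⇒consistent {q} m out = good⇒consistent λ n →
    trans (cong (bad q) (↾-cong (≗-sym (sequence-δ m)) n)) (outside⇒good q out n)

  consistent⇒outside : ∀ {q y} (m : X.Name y) → Consistent q y → Outside X (conflicts q) (X.δ y m)
  consistent⇒outside {q} m con = good⇒outside q λ n →
    trans (cong (bad q) (↾-cong (sequence-δ m) n)) (consistent⇒good con n)

  choose : ∀ p → _⇉_.dom g p → ∃ (_⇉_.values g p)
  choose p (_ , d) = let (x , x∈B) = inhabited d ; (y , m , y≈x) = X.δ-onto x in
    y , tt , m , F.values-resp (A₋.refl {RepresentedSpace.δ (A₋ X) p tt})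
                               (Setoid.sym X.setoid y≈x) (complete d x∈B)
    where module A₋ = Setoid (RepresentedSpace.setoid (A₋ X))

  solution : ∀ {q₀} → _⇉_.dom (loop g) q₀ → ∃ (Outside X (conflicts q₀))
  solution q₀∈dom = let (q , x , chain) = chain-exists choose q₀∈dom in
    _ , consistent⇒outside (layout-name (λ i → proj₁ (proj₂ (Chain.answers chain i))))
                           (chain⇒consistent chain)

  module _ (single-valued : ∀ {p x x′} →
            _⇉_.dom g p → _⇉_.values g p x → _⇉_.values g p x′ → x ≗ x′) where

    consistent-unique : ∀ {q₀ y y′} → _⇉_.dom (loop g) q₀ → X.Name y → X.Name y′ →
                        Consistent q₀ y → Consistent q₀ y′ → y ≗ y′
    consistent-unique q₀∈dom m m′ con con′ =
      let (q  , chain  , enc ) = consistent⇒chain q₀∈dom con (row-name m)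
          (q′ , chain′ , enc′) = consistent⇒chain q₀∈dom con′ (row-name m′)
      in ≗-trans (layout-η enc)
           (≗-trans (chain-unique single-valued chain chain′) (≗-sym (layout-η enc′)))

  -- The hypothesis is where the problems differ: for `C` it is nonemptiness, which is `solution`,
  -- and for `UC` also uniqueness.
  ^∞-≤sW : (∀ {q₀} → _⇉_.dom (loop g) q₀ → F.dom (RepresentedSpace.δ (A₋ X) (conflicts q₀) tt)) →
           F ^∞ ≤sW F
  ^∞-≤sW closed-dom = Scan.machine , Conflicts.transducer ,
    Scan.machine-computable scan-computable , conflicts-computable , λ G G⊢ q₀ _ q₀∈dom →
    let (e , m , v) = G⊢ (conflicts q₀) tt (closed-dom q₀∈dom)
        (q , chain , enc) = consistent⇒chain q₀∈dom (outside⇒consistent m (sound v)) (row-name m)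
    in (((conflicts q₀ , Conflicts.transduce conflicts-causal q₀) , e) , ⟨ q ⟩ω , scan-sup enc) ,
       tt , chain-values chain

cantor-sequence-δ : ∀ {p} (n : RepresentedSpace.Name cantor p) → bit ∘ proj₁ n ≗ p
cantor-sequence-δ = proj₂

cantor-row-name : ∀ {y} → RepresentedSpace.Name cantor y →
                  ∀ i → RepresentedSpace.Name cantor (row y i)
cantor-row-name (x , eq) i = (λ j → x (pair (suc i) j)) , λ j → eq (pair (suc i) j)

cantor-layout-name : ∀ {o x} → (∀ i → RepresentedSpace.Name cantor (x i)) →
                     RepresentedSpace.Name cantor (layout o x)
cantor-layout-name {o} {x} names = (λ m → bits (unpair m)) , λ m → eq (unpair m)
  where
  bits : ℕ × ℕ → Bool
  bits (zero  , m) = o (proj₁ (unpair m)) ≡ᵇ proj₁ (unpair (proj₂ (unpair m)))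
  bits (suc i , j) = proj₁ (names i) j
  eq : ∀ ij → bit (bits ij) ≡ entry o x ij
  eq (zero  , m) = refl
  eq (suc i , j) = proj₂ (names i) j

module C-Cantor = ClosedChoice 2^ℕ (C 2^ℕ)
  cantor-sequence-δ cantor-row-name cantor-layout-name id id (λ _ → id)

module C-Baire = ClosedChoice ℕ^ℕ (C ℕ^ℕ)
  (λ _ _ → refl) (λ _ _ → tt) (λ _ → tt) id id (λ _ → id)

module UC-Baire = ClosedChoice ℕ^ℕ (UC ℕ^ℕ)
  (λ _ _ → refl) (λ _ _ → tt) (λ _ → tt) (λ (x , x∈B , _) → x , x∈B) id (λ _ → id)

UC^∞-≤sW : UC ℕ^ℕ ^∞ ≤sW UC ℕ^ℕ
UC^∞-≤sW = UC-Baire.^∞-≤sW λ q₀∈dom → let (y , out) = UC-Baire.solution q₀∈dom in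
  y , out , λ y′ out′ → UC-Baire.consistent-unique single-valued q₀∈dom tt tt
    (UC-Baire.outside⇒consistent tt out′) (UC-Baire.outside⇒consistent tt out)
  where
  single-valued : ∀ {p x x′} → _⇉_.dom (UC ℕ^ℕ ʳ) p → _⇉_.values (UC ℕ^ℕ ʳ) p x →
                  _⇉_.values (UC ℕ^ℕ ʳ) p x′ → x ≗ x′
  single-valued (_ , _ , _ , unique) (_ , _ , v) (_ , _ , v′) =
    ≗-trans (unique _ v) (≗-sym (unique _ v′))

-- Weak König's lemma

-- In a name of a tree, the value 0 at position `c` says that the word with code `c` is missing,
-- which excludes the answers through this very word.
pruned : ℕ × ℕ × ℕ → Bool
pruned (n , v , c) = (n ≡ᵇ c) ∧ (v ≡ᵇ 0)

prunedᶜ : Computable pruned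
prunedᶜ = (fstᶜ varᶜ ≡ᵇᶜ sndᶜ (sndᶜ varᶜ)) ∧ᶜ isZeroᶜ (fstᶜ (sndᶜ varᶜ))

pruned-reflects : ∀ n v c → Reflects (n ≡ c × v ≡ 0) (pruned (n , v , c))
pruned-reflects n v c = ≡ᵇ-reflects n c ×-reflects ≡ᵇ-reflects v 0

binary : List ℕ → Bool
binary w = allBelow (length w) λ j → pad w j <ᵇ 2

binary-reflects : ∀ w → Reflects (All (_< 2) w) (binary w)
binary-reflects w = go (allBelow-reflects (λ j → <ᵇ-reflects-< (pad w j) 2) (length w))
  where
  to : ∀ w → (∀ j → j < length w → pad w j < 2) → All (_< 2) w
  to []      _ = []
  to (x ∷ w) h = h 0 z<s ∷ to w (λ j j< → h (suc j) (s<s j<))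
  from : ∀ {w} → All (_< 2) w → ∀ j → j < length w → pad w j < 2
  from (x< ∷ _)  zero    _        = x<
  from (_  ∷ w<) (suc j) (s≤s j<) = from w< j j<
  go : ∀ {b} → Reflects (∀ j → j < length w → pad w j < 2) b → Reflects (All (_< 2) w) b
  go (ofʸ h)  = ofʸ (to w h)
  go (ofⁿ ¬h) = ofⁿ (¬h ∘ from)

all-bits : ∀ w → All (_< 2) (map bit w)
all-bits []          = []
all-bits (false ∷ w) = z<s ∷ all-bits w
all-bits (true  ∷ w) = s<s z<s ∷ all-bits w

open Constraints pruned using () renaming
  (bad to badᵂ; bad-mono to badᵂ-mono; bad-reflects to badᵂ-reflects)

tree : Baire → BinaryTree
tree q = record
  { χ             = λ w → not (badᵂ q (map bit w))
  ; prefix-closed = λ {u} {v} u⊑v good → cong not (reflects-false (badᵂ-reflects q (map bit u))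
      λ bad → reflects-refuted (badᵂ-reflects q (map bit v)) (not-injective good)
        (badᵂ-mono q (Prefixₚ.map⁺ bit bit (Prefix.map (cong bit) u⊑v)) bad))
  }

treeName : Baire → Baire
treeName q n = bit (binary (decode n) ∧ not (badᵂ q (decode n)))

treeName-causal : Causal treeName
treeName-causal n p≡q = cong (λ b → bit (binary (decode n) ∧ not b))
  (Constraints.bad-local pruned (decode n) λ k< → p≡q (<⇒≤ (<-≤-trans k< (length-decode≤ n))))

treeName-characteristic : ∀ q → IsCharacteristic (treeName q) (tree q)
treeName-characteristic q =
  (λ w → trans (cong (λ u → bit (binary u ∧ not (badᵂ q u))) (decode-code (map bit w)))
    (cong (λ b → bit (b ∧ not (badᵂ q (map bit w))))
      (reflects-true (binary-reflects (map bit w)) (all-bits w)))) ,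
  (λ u u≮2 → trans (cong (λ u → bit (binary u ∧ not (badᵂ q u))) (decode-code u))
    (cong (λ b → bit (b ∧ not (badᵂ q u))) (reflects-false (binary-reflects u) u≮2)))

module TreeName = Transducer treeName

treeName-computable : IsComputable TreeName.transducer
treeName-computable = TreeName.transducer-computable (bitᶜ
  (binaryᶜ (decodeᶜ (sndᶜ varᶜ))
   ∧ᶜ notᶜ (Constraints.badᶜ pruned prunedᶜ (fstᶜ varᶜ) (decodeᶜ (sndᶜ varᶜ)))))
  where
  binaryᶜ : {Γ : Set} ⦃ _ : Coded Γ ⦄ {w : Γ → List ℕ} → Computable w → Computable (binary ∘ w)
  binaryᶜ cw = allBelowᶜ (lengthᶜ cw) (padᶜ (cw $ᶜ fstᶜ varᶜ) (sndᶜ varᶜ) <ᵇᶜ constᶜ 2)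

path-infinite : ∀ {T x} → IsPath T x → IsInfinite T
path-infinite {T} {x} path ws = x ↾ n , path n , λ x∈ws → <-irrefl refl
  (subst (_≤ sum (map length ws)) (length-applyUpTo x n) (length≤sum ws x∈ws))
  where
  -- The sum bounds the length of each word in `ws`, so the prefix of length `n` is none of them.
  n = suc (sum (map length ws))
  length≤sum : ∀ ws {w : List Bool} → w ∈ ws → length w ≤ sum (map length ws)
  length≤sum (w ∷ ws) (here refl) = m≤m+n (length w) _
  length≤sum (w ∷ ws) (there w∈) = ≤-trans (length≤sum ws w∈) (m≤n+m _ (length w))

module WKL∞ where

  g : baire ⇉ baire
  g = WKL ʳ

  word-bits : ∀ {x : ℕ → Bool} {y} → bit ∘ x ≗ y → ∀ n → y ↾ n ≡ map bit (x ↾ n)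
  word-bits {x} x≗y n = trans (sym (↾-cong x≗y n)) (sym (map-applyUpTo x bit n))

  respects : ∀ p {y} → _⇉_.values g p y → ∀ w n → w ≺ y → ¬ T (pruned (n , p n , code w))
  respects p {y} ((T′ , on , _) , (x , x≗y) , path) w n w≺ t
    with refl , p≡0 ← reflects-proved (pruned-reflects n (p n) (code w)) (Equivalence.to T-≡ t)
    = contradiction (trans (sym p≡0)
        (trans (cong (p ∘ code) (trans (sym w≺) (word-bits x≗y (length w))))
        (trans (on (x ↾ length w)) (cong bit (path (length w)))))) λ ()

  respected : ∀ p {y} → _⇉_.dom g p → RepresentedSpace.Name cantor y →
              (∀ w n → w ≺ y → ¬ T (pruned (n , p n , code w))) → _⇉_.values g p y
  respected p {y} (char@(T′ , on , _) , _) (x , x≗y) h = char , (x , x≗y) , path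
    where
    path : IsPath T′ x
    path n with χ T′ (x ↾ n) in eq
    ... | true  = refl
    ... | false = contradiction (Equivalence.from T-≡ (reflects-true
      (pruned-reflects (code (y ↾ n)) (p (code (y ↾ n))) (code (y ↾ n)))
      (refl , trans (cong (p ∘ code) (word-bits x≗y n)) (trans (on (x ↾ n)) (cong bit eq)))))
      (h (y ↾ n) (code (y ↾ n)) (↾-≺ y n))

  open Constraints pruned
  open Chains g
  open Solutions pruned (RepresentedSpace.Name cantor) (λ (_ , m , _) → m) respects respected

  path⇒consistent : ∀ {q x y} → bit ∘ x ≗ y → IsPath (tree q) x → Consistent q y
  path⇒consistent {q} x≗y path = good⇒consistent λ m →
    trans (cong (bad q) (word-bits x≗y m)) (not-injective (path m))

  consistent⇒path : ∀ {q x y} → bit ∘ x ≗ y → Consistent q y → IsPath (tree q) x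
  consistent⇒path {q} x≗y con m =
    cong not (trans (cong (bad q) (sym (word-bits x≗y m))) (consistent⇒good con m))

  module _ {G : PartialFunction} (G⊢WKL : G ⊢ WKL) where

    -- That infinite trees have paths is not constructive, but the realizer of WKL supplies them.
    choose : ∀ p → _⇉_.dom g p → ∃ (_⇉_.values g p)
    choose p (char , inf) = let (d , m , path) = G⊢WKL p char inf in
      PartialFunction.app G p d , char , m , path

    tree-infinite : ∀ {q₀} → _⇉_.dom (loop g) q₀ → IsInfinite (tree q₀)
    tree-infinite {q₀} q₀∈dom =
      let (q , x , chain) = chain-exists choose q₀∈dom
          (y , y≗) = cantor-layout-name (λ i → proj₁ (proj₂ (Chain.answers chain i)))
      in path-infinite {tree q₀} {y} (consistent⇒path y≗ (chain⇒consistent chain))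

  ^∞-≤sW : WKL ^∞ ≤sW WKL
  ^∞-≤sW = Scan.machine , TreeName.transducer , Scan.machine-computable scan-computable ,
    treeName-computable , λ G G⊢ q₀ _ q₀∈dom →
    let (e , m , path) = G⊢ (treeName q₀) (tree q₀ , treeName-characteristic q₀)
                           (tree-infinite {G} G⊢ q₀∈dom)
        (q , chain , enc) = consistent⇒chain q₀∈dom (path⇒consistent (proj₂ m) path)
                              (cantor-row-name m)
    in (((treeName q₀ , TreeName.transduce treeName-causal q₀) , e) , ⟨ q ⟩ω , scan-sup enc) ,
       tt , chain-values chain

corollary27 : (C 2^ℕ ^∞ ≡sW C 2^ℕ) ×
    (C ℕ^ℕ ^∞ ≡sW C ℕ^ℕ) ×
    (UC ℕ^ℕ ^∞ ≡sW UC ℕ^ℕ) ×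
    (WKL ^∞ ≡sW WKL)
corollary27 =
  (C-Cantor.^∞-≤sW C-Cantor.solution , ≤sW-^∞ (C 2^ℕ)) ,
  (C-Baire.^∞-≤sW C-Baire.solution , ≤sW-^∞ (C ℕ^ℕ)) ,
  (UC^∞-≤sW , ≤sW-^∞ (UC ℕ^ℕ)) ,
  (WKL∞.^∞-≤sW , ≤sW-^∞ WKL)
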